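{- Let $G$ be a $\Delta$-critical graph with an edge $xy\in E(G)$, and let $\varphi \in \mathcal{C}^{\Delta}(G-xy)$. Suppose $B = (x, xy, y, yz, z, zv_1, v_1,\ldots, zv_p, v_p)$ is a short broom with respect to $xy$ and $\varphi$. For each color $\alpha\in\{1,\dots,\Delta\}$ define $m_{\varphi,B}(\alpha)=|\{v\in V(B) : \alpha\in\overline{\varphi}(v)\}|-1$ if $\alpha$ is missing at some vertex of $V(B)=\{x,y,z,v_1,\dots,v_p\}$, and $m_{\varphi,B}(\alpha)=0$ otherwise. Then $$\sum_{\alpha \in \{1,\dots,\Delta\}} m_{\varphi, B}(\alpha) \leq 1.$$
   Context: All graphs are finite and simple. $\Delta=\Delta(G)$ is the maximum degree of $G$, and $\chi'(G)$ is the chromatic index (the least $k$ such that $G$ has a proper $k$-edge-coloring). $G$ is $\Delta$-critical if $\chi'(G)=\Delta(G)+1$ and $\chi'(H)<\chi'(G)$ for every proper subgraph $H$ of $G$. $G-xy$ is the graph obtained by deleting the edge $xy$, and $\mathcal{C}^{k}(H)$ is the set of all proper edge colorings of $H$ with colors from $\{1,\dots,k\}$. For $\varphi\in\mathcal{C}^{\Delta}(G-xy)$ and a vertex $v$, $\overline{\varphi}(v)$ is the set of colors in $\{1,\dots,\Delta\}$ not appearing on any edge of $G-xy$ incident with $v$ (the colors missing at $v$); for $X\subseteq V(G)$, $\overline{\varphi}(X)=\bigcup_{v\in X}\overline{\varphi}(v)$. A short broom with respect to $xy$ and $\varphi\in\mathcal{C}^{\Delta}(G-xy)$ is a sequence $B=(x,xy,y,yz,z,zv_1,v_1,zv_2,v_2,\ldots,zv_p,v_p)$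 with $p\ge 1$, consisting of distinct vertices $x,y,z,v_1,\dots,v_p$ and edges $xy,yz,zv_1,\dots,zv_p$ of $G$, such that $\varphi(yz)\in\overline{\varphi}(x)$ and $\varphi(zv_i)\in\overline{\varphi}(\{x,y,z,v_1,\dots,v_{i-1}\})$ for every $i\in\{1,\dots,p\}$. -}

module Defs where

open import Data.Fin.Base using (Fin; toℕ)
open import Data.Fin.Properties using (any?; _≟_)
open import Data.Fin.Subset using (Subset; _∈_; _⊆_)
open import Data.List.Base
  using (List; []; _∷_; allFin; filter; foldr; length; lookup; map; take)
open import Data.List.Relation.Unary.Any using (Any)
open import Data.List.Relation.Unary.Unique.Propositional using (Unique)
open import Data.Nat.Base using (ℕ; suc; _∸_; _⊔_; _≤_; _<_)
open import Data.Nat.ListAction using (sum)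
open import Data.Product.Base using (Σ-syntax; ∃-syntax; _×_; _,_)
open import Data.Sum.Base using (_⊎_; inj₁; inj₂)
open import Level using (0ℓ)
open import Relation.Binary.Core using (Rel)
open import Relation.Binary.Definitions using (Decidable; Irreflexive; Symmetric)
open import Relation.Binary.PropositionalEquality using (_≡_; _≢_; trans; sym)
open import Relation.Nullary using (Dec; yes; no; ¬_)
open import Relation.Nullary.Decidable using (map′; ¬?; _×-dec_; _⊎-dec_)

private
  variable
    n k : ℕ

-- The vertex set is a subset of Fin n, rather than all of Fin n, so that the
-- subgraphs of a graph (including those with fewer vertices) have the same type.
record Graph (n : ℕ) : Set₁ where
  field
    vertices   : Subset n
    Adj        : Rel (Fin n) 0ℓ
    adj?       : Decidable Adj
    adj-sym    : Symmetric Adj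
    adj-irrefl : Irreflexive _≡_ Adj
    adj⇒∈      : ∀ {u v} → Adj u v → u ∈ vertices

open Graph public

infix 4 _⊑_ _⊏_

_⊑_ : Graph n → Graph n → Set
H ⊑ G = vertices H ⊆ vertices G × (∀ {u v} → Adj H u v → Adj G u v)

_⊏_ : Graph n → Graph n → Set
H ⊏ G = H ⊑ G × ¬ (G ⊑ H)

degree : Graph n → Fin n → ℕ
degree {n} G v = length (filter (adj? G v) (allFin n))

-- Elements of Fin n outside the vertex set have degree 0, so they do not
-- affect the maximum.
Δ : Graph n → ℕ
Δ {n} G = foldr _⊔_ 0 (map (degree G) (allFin n))

SameEdge : (x y u v : Fin n) → Set
SameEdge x y u v = (u ≡ x × v ≡ y) ⊎ (u ≡ y × v ≡ x)

sameEdge? : (x y u v : Fin n) → Dec (SameEdge x y u v)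
sameEdge? x y u v = ((u ≟ x) ×-dec (v ≟ y)) ⊎-dec ((u ≟ y) ×-dec (v ≟ x))

deleteEdge : Graph n → Fin n → Fin n → Graph n
deleteEdge G x y = record
  { vertices   = vertices G
  ; Adj        = λ u v → Adj G u v × ¬ SameEdge x y u v
  ; adj?       = λ u v → adj? G u v ×-dec ¬? (sameEdge? x y u v)
  ; adj-sym    = λ (e , ≠xy) → adj-sym G e , λ where
      (inj₁ (v≡x , u≡y)) → ≠xy (inj₂ (u≡y , v≡x))
      (inj₂ (v≡y , u≡x)) → ≠xy (inj₁ (u≡x , v≡y))
  ; adj-irrefl = λ u≡v (e , _) → adj-irrefl G u≡v e
  ; adj⇒∈      = λ (e , _) → adj⇒∈ G e
  }

-- An edge uv has the two orientations Adj G u v and Adj G v u. Since adjacency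
-- is symmetric, color-sym also makes the color independent of the adjacency proof.
record EdgeColoring (G : Graph n) (k : ℕ) : Set where
  field
    color     : ∀ {u v} → Adj G u v → Fin k
    color-sym : ∀ {u v} (e : Adj G u v) (f : Adj G v u) → color e ≡ color f
    proper    : ∀ {u v w} → v ≢ w →
                (e : Adj G u v) (f : Adj G u w) → color e ≢ color f

open EdgeColoring public

IsChromaticIndex : Graph n → ℕ → Set
IsChromaticIndex G k = EdgeColoring G k × (∀ j → EdgeColoring G j → k ≤ j)

record Critical (G : Graph n) : Set₁ where
  field
    class2  : IsChromaticIndex G (suc (Δ G))
    minimal : ∀ (H : Graph n) → H ⊏ G →
              ∃[ j ] IsChromaticIndex H j × j < suc (Δ G)

module _ {G : Graph n} (φ : EdgeColoring G k) where

  Appears : Fin n → Fin k → Set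
  Appears v α = ∃[ w ] Σ[ e ∈ Adj G v w ] color φ e ≡ α

  Missing : Fin n → Fin k → Set
  Missing v α = ¬ Appears v α

  MissingOn : List (Fin n) → Fin k → Set
  MissingOn X α = Any (λ v → Missing v α) X

  missing? : ∀ v α → Dec (Missing v α)
  missing? v α = ¬? (any? appearsAt?)
    where
    appearsAt? : ∀ w → Dec (Σ[ e ∈ Adj G v w ] color φ e ≡ α)
    appearsAt? w with adj? G v w
    ... | no ¬e = no λ (e , _) → ¬e e
    ... | yes e = map′ (e ,_)
      (λ (f , f≡α) → trans (color-sym φ e (adj-sym G f))
                       (trans (sym (color-sym φ f (adj-sym G f))) f≡α))
      (color φ e ≟ α)

-- The edges yz and zvᵢ are taken in G - xy, where φ is defined. As the vertices
-- are distinct, none of them is xy, so this is the same as being an edge of G.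
record ShortBroom (G : Graph n) {x y : Fin n} (xy : Adj G x y)
                  (φ : EdgeColoring (deleteEdge G x y) k) : Set where
  field
    z           : Fin n
    vs          : List (Fin n)
    p≥1         : 1 ≤ length vs
    distinct    : Unique (x ∷ y ∷ z ∷ vs)
    yz          : Adj (deleteEdge G x y) y z
    zv          : ∀ i → Adj (deleteEdge G x y) z (lookup vs i)
    yz-missing  : Missing φ x (color φ yz)
    zv-missing  : ∀ i → MissingOn φ (x ∷ y ∷ z ∷ take (toℕ i) vs) (color φ (zv i))

  broomVertices : List (Fin n)
  broomVertices = x ∷ y ∷ z ∷ vs

open ShortBroom public using (broomVertices)

-- Truncated subtraction gives 0 for a color missing at no vertex of the broom;
-- the vertices in the list are distinct, so its filtered length is a cardinality.
m : {G : Graph n} {x y : Fin n} {xy : Adj G x y}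
    (φ : EdgeColoring (deleteEdge G x y) k) → ShortBroom G xy φ → Fin k → ℕ
m φ B α = length (filter (λ v → missing? φ v α) (broomVertices B)) ∸ 1

∑-colors : (Fin k → ℕ) → ℕ
∑-colors {k} f = sum (map f (allFin k))

{-# OPTIONS --safe #-}
-- Color xy as nothing, write δ for the color of yz, and let C be the set of colors missing at x
-- or y. As in Vizing's argument, recoloring xy by δ and uncoloring yz turns the broom edges
-- reached from a color b missing at y into a fan at z. For q ≠ δ missing at x, follow the
-- (q,b)-path from y until it first meets z. If it avoids z, exchanging q and b on it exchanges
-- the roles of x and y for these colors; otherwise exchanging the colors before z produces
-- a coloring with a single uncolored edge at z whose fan contains the edges reached from q.
-- All these colorings have the same colors missing at the broom vertices other than x and y, so
-- elementarity of fans forbids most coincidences. Two colors of C missing at broom vertices are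
-- moved to δ and b by exchanges off the path from y, and are excluded by shifting both fans; a
-- color p ∉ C missing at two broom vertices becomes b at one of them by a (p,b)-exchange.
module Submission where

open import Defs
open import Data.Nat.Base using (ℕ; _≤_)
open import Data.Fin.Base using (Fin)

open import Data.Empty using (⊥; ⊥-elim)
open import Data.Fin.Base using (zero; suc; toℕ)
open import Data.Fin.Properties using (_≟_; any?; pigeonhole)
import Data.Fin.Properties as Fin
open import Data.List.Base using (List; []; _∷_; allFin; filter; foldr; length; lookup; map; take)
open import Data.List.Membership.Propositional using (_∈_)
open import Data.List.Membership.Propositional.Properties
  using (∈-allFin; ∈-filter⁺; ∈-filter⁻; ∈-lookup)
import Data.List.Relation.Unary.All as All
open import Data.List.Relation.Unary.All using (_∷_)
open import Data.List.Relation.Unary.AllPairs using (_∷_)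
open import Data.List.Relation.Unary.Any using (Any; here; there; index)
open import Data.List.Relation.Unary.Any.Properties using (lookup-index)
open import Data.List.Relation.Unary.Unique.Propositional using (Unique)
open import Data.List.Relation.Unary.Unique.Propositional.Properties using (allFin⁺; filter⁺)
open import Data.Maybe.Base using (Maybe; just; nothing)
import Data.Maybe.Base as Maybe
open import Data.Maybe.Properties using (≡-dec; just-injective)
open import Data.Nat.Base using (zero; suc; _<_; z≤n; s≤s; _⊔_; _∸_)
open import Data.Nat.ListAction using (sum)
open import Data.Nat.Properties
  using (≤-refl; ≤-trans; ≤-antisym; m≤n⇒m<n∨m≡n; m≤n⇒m≤1+n; m≤m⊔n; m≤n⊔m; n≮n; _≤?_; ≰⇒>)
open import Data.Product.Base using (Σ-syntax; ∃-syntax; _×_; _,_; proj₁; proj₂)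
open import Data.Sum.Base using (_⊎_; inj₁; inj₂; reduce)
open import Function.Base using (_∘_; case_of_)
open import Relation.Binary.PropositionalEquality
  using (_≡_; _≢_; refl; sym; trans; cong; subst)
open import Relation.Nullary using (Dec; yes; no; ¬_)
open import Relation.Nullary.Decidable using (¬?; map′; _⊎-dec_)

-- The obstacle is that a fan is centered at an end of the uncolored edge, while the broom edges at
-- z hang from colors missing at x and at y together. One recoloring serves all colors missing at y,
-- but each color missing at x needs its own, so two branches that start from different colors
-- missing at x need not lie in a common fan. Hence statements about one branch come before
-- statements about two, and the color b, missing at y, serves as a bridge between branches. If the
-- path from y enters z through its b-edge, the recoloring frees b at z instead of δ, so a broom
-- vertex missing δ is not refuted at once; this is the only outcome in which a second fan has to be
-- shifted. The order of the vertices of the broom is forgotten: only reachability through missing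
-- colors is used. Criticality enters as the absence of a proper coloring with Δ colors, and b
-- exists because y has at most Δ neighbors, one of them along the uncolored edge.

private
  variable
    n k : ℕ

-- All intermediate results are refutations, so predicates may be assumed decidable.
¬¬-decidable : (P : Fin n → Set) → ¬ ¬ (∀ i → Dec (P i))
¬¬-decidable {zero}  P h = h λ ()
¬¬-decidable {suc n} P h = ¬¬-decidable (P ∘ suc) λ d →
  let extend = λ (d₀ : Dec (P zero)) → h λ { zero → d₀ ; (suc i) → d i }
  in extend (no λ p → extend (yes p))

-- Partial edge-colorings

-- The value nothing stands for non-adjacent as well as for uncolored pairs.
Partial : ℕ → ℕ → Set
Partial n k = Fin n → Fin n → Maybe (Fin k)

record Has (c : Partial n k) (u v : Fin n) (e : Fin k) : Set where
  no-eta-equality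
  pattern
  constructor has
  field color≡ : c u v ≡ just e

open Has public

Misses : Partial n k → Fin n → Fin k → Set
Misses c v e = ∀ w → ¬ Has c v w e

record Proper (c : Partial n k) : Set where
  no-eta-equality
  field
    symm  : ∀ u v → c u v ≡ c v u
    inj   : ∀ {u v w e} → Has c u v e → Has c u w e → v ≡ w
    irref : ∀ u → c u u ≡ nothing

open Proper public

flip : ∀ {c : Partial n k} → Proper c → ∀ {u v e} → Has c u v e → Has c v u e
flip P (has h) = has (trans (symm P _ _) h)

Has-≢ : ∀ {c : Partial n k} → Proper c → ∀ {u v e} → Has c u v e → u ≢ v
Has-≢ P (has h) refl with trans (sym (irref P _)) h
... | ()

Has-unique : ∀ {c : Partial n k} {u v e f} → Has c u v e → Has c u v f → e ≡ f
Has-unique (has h) (has h′) = just-injective (trans (sym h) h′)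

Has-cong : ∀ {c : Partial n k} {u v w e} → v ≡ w → Has c u v e → Has c u w e
Has-cong refl h = h

nothing-≢ : ∀ {c : Partial n k} {u v e} → c u v ≡ nothing → ¬ Has c u v e
nothing-≢ p (has h) with trans (sym p) h
... | ()

SE-flip : ∀ {u v s t : Fin n} → SameEdge u v s t → SameEdge u v t s
SE-flip (inj₁ (p , q)) = inj₂ (q , p)
SE-flip (inj₂ (p , q)) = inj₁ (q , p)

SE-comm : ∀ {u v s t : Fin n} → SameEdge u v s t → SameEdge v u s t
SE-comm (inj₁ (p , q)) = inj₂ (p , q)
SE-comm (inj₂ (p , q)) = inj₁ (p , q)

opaque
  set : Partial n k → Fin n → Fin n → Maybe (Fin k) → Partial n k
  set c u v m s t with sameEdge? u v s t
  ... | yes _ = m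
  ... | no _  = c s t

module _ (c : Partial n k) (u v : Fin n) (m : Maybe (Fin k)) where

  opaque
    unfolding set

    set-on : ∀ {s t} → SameEdge u v s t → set c u v m s t ≡ m
    set-on {s} {t} p with sameEdge? u v s t
    ... | yes _ = refl
    ... | no ¬p = ⊥-elim (¬p p)

    set-off : ∀ {s t} → ¬ SameEdge u v s t → set c u v m s t ≡ c s t
    set-off {s} {t} ¬p with sameEdge? u v s t
    ... | yes p = ⊥-elim (¬p p)
    ... | no _  = refl

  set-symm : (∀ s t → c s t ≡ c t s) → ∀ s t → set c u v m s t ≡ set c u v m t s
  set-symm sy s t with sameEdge? u v s t
  ... | yes p = trans (set-on p) (sym (set-on (SE-flip p)))
  ... | no ¬p = trans (set-off ¬p) (trans (sy s t) (sym (set-off (¬p ∘ SE-flip))))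

  set-irref : u ≢ v → (∀ s → c s s ≡ nothing) → ∀ s → set c u v m s s ≡ nothing
  set-irref u≢v ir s with sameEdge? u v s s
  ... | yes (inj₁ (refl , p)) = ⊥-elim (u≢v p)
  ... | yes (inj₂ (refl , p)) = ⊥-elim (u≢v (sym p))
  ... | no ¬p = trans (set-off ¬p) (ir s)

module Erase {c : Partial n k} (P : Proper c) {u v : Fin n} (u≢v : u ≢ v) where

  erase : Partial n k
  erase = set c u v nothing

  erase-Has : ∀ {s t e} → Has erase s t e → Has c s t e × ¬ SameEdge u v s t
  erase-Has {s} {t} (has h) with sameEdge? u v s t
  ... | no ¬p = has (trans (sym (set-off c u v nothing ¬p)) h) , ¬p
  ... | yes p = ⊥-elim (nothing-≢ {c = erase} (set-on c u v nothing p) (has h))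

  erase-Has⁻ : ∀ {s t e} → ¬ SameEdge u v s t → Has c s t e → Has erase s t e
  erase-Has⁻ ¬p (has h) = has (trans (set-off c u v nothing ¬p) h)

  opaque
    erase-Proper : Proper erase
    erase-Proper = record
      { symm  = set-symm c u v nothing (symm P)
      ; inj   = λ h h′ → inj P (proj₁ (erase-Has h)) (proj₁ (erase-Has h′))
      ; irref = set-irref c u v nothing u≢v (irref P)
      }

  erase-Misses : ∀ {w e} → Misses c w e → Misses erase w e
  erase-Misses m t h = m t (proj₁ (erase-Has h))

  module _ {e : Fin k} (h : Has c u v e) where

    erase-Misses₁ : Misses erase u e
    erase-Misses₁ t h′ with erase-Has h′
    ... | g , ¬p = ¬p (inj₁ (refl , inj P g h))

    erase-Misses₂ : Misses erase v e
    erase-Misses₂ t h′ with erase-Has h′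
    ... | g , ¬p = ¬p (inj₂ (refl , inj P g (flip P h)))

  erase-nothing : ∀ {s t} → erase s t ≡ nothing → SameEdge u v s t ⊎ c s t ≡ nothing
  erase-nothing {s} {t} h with sameEdge? u v s t
  ... | yes p = inj₁ p
  ... | no ¬p = inj₂ (trans (sym (set-off c u v nothing ¬p)) h)

  erase-on : erase u v ≡ nothing
  erase-on = set-on c u v nothing (inj₁ (refl , refl))

module Put {c : Partial n k} (P : Proper c) {u v : Fin n} (u≢v : u ≢ v)
           (un : c u v ≡ nothing) (e : Fin k)
           (mu : Misses c u e) (mv : Misses c v e) where

  put : Partial n k
  put = set c u v (just e)

  put-Has : ∀ {s t f} → Has put s t f → (SameEdge u v s t × f ≡ e) ⊎ Has c s t f
  put-Has {s} {t} (has h) with sameEdge? u v s t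
  ... | yes p = inj₁ (p , just-injective (trans (sym h) (set-on c u v (just e) p)))
  ... | no ¬p = inj₂ (has (trans (sym (set-off c u v (just e) ¬p)) h))

  SE-nothing : ∀ {s t} → SameEdge u v s t → c s t ≡ nothing
  SE-nothing (inj₁ (refl , refl)) = un
  SE-nothing (inj₂ (refl , refl)) = trans (symm P _ _) un

  SE-misses : ∀ {s t} → SameEdge u v s t → Misses c s e
  SE-misses (inj₁ (refl , _)) = mu
  SE-misses (inj₂ (refl , _)) = mv

  SE-same : ∀ {s t t′} → SameEdge u v s t → SameEdge u v s t′ → t ≡ t′
  SE-same (inj₁ (refl , refl)) (inj₁ (_ , refl)) = refl
  SE-same (inj₁ (refl , refl)) (inj₂ (p , _)) = ⊥-elim (u≢v p)
  SE-same (inj₂ (refl , refl)) (inj₁ (p , _)) = ⊥-elim (u≢v (sym p))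
  SE-same (inj₂ (refl , refl)) (inj₂ (_ , refl)) = refl

  put-Has⁻ : ∀ {s t f} → Has c s t f → Has put s t f
  put-Has⁻ h = has (trans (set-off c u v (just e) λ p → nothing-≢ (SE-nothing p) h) (color≡ h))

  put-on : Has put u v e
  put-on = has (set-on c u v (just e) (inj₁ (refl , refl)))

  opaque
    put-Proper : Proper put
    put-Proper = record
      { symm = set-symm c u v (just e) (symm P)
      ; inj = inj′
      ; irref = set-irref c u v (just e) u≢v (irref P)
      }
      where
      inj′ : ∀ {s t t′ f} → Has put s t f → Has put s t′ f → t ≡ t′
      inj′ h h′ with put-Has h | put-Has h′
      ... | inj₁ (p , _)    | inj₁ (p′ , _)   = SE-same p p′
      ... | inj₁ (p , refl) | inj₂ g          = ⊥-elim (SE-misses p _ g)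
      ... | inj₂ g          | inj₁ (p , refl) = ⊥-elim (SE-misses p _ g)
      ... | inj₂ g          | inj₂ g′         = inj P g g′

  put-Misses : ∀ {w f} → f ≢ e → Misses c w f → Misses put w f
  put-Misses f≢e m t h with put-Has h
  ... | inj₁ (_ , p) = f≢e p
  ... | inj₂ g       = m t g

  put-Misses-off : ∀ {w f} → w ≢ u → w ≢ v → Misses c w f → Misses put w f
  put-Misses-off w≢u w≢v m t h with put-Has h
  ... | inj₁ (inj₁ (p , _) , _) = w≢u p
  ... | inj₁ (inj₂ (p , _) , _) = w≢v p
  ... | inj₂ g = m t g

  put-nothing : ∀ {s t} → put s t ≡ nothing → c s t ≡ nothing × ¬ SameEdge u v s t
  put-nothing {s} {t} h with sameEdge? u v s t
  ... | no ¬p = trans (sym (set-off c u v (just e) ¬p)) h , ¬p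
  ... | yes p = ⊥-elim (nothing-≢ {c = put} h (has (set-on c u v (just e) p)))

-- Kempe exchanges

transpose : (a b : Fin k) → Fin k → Fin k
transpose a b e with e ≟ a
... | yes _ = b
... | no _ with e ≟ b
...   | yes _ = a
...   | no _  = e

transpose-a : (a b : Fin k) → transpose a b a ≡ b
transpose-a a b with a ≟ a
... | yes _ = refl
... | no ¬p = ⊥-elim (¬p refl)

transpose-b : (a b : Fin k) → transpose a b b ≡ a
transpose-b a b with b ≟ a
... | yes p = p
... | no _ with b ≟ b
...   | yes _ = refl
...   | no ¬p = ⊥-elim (¬p refl)

transpose-other : (a b : Fin k) {e : Fin k} → e ≢ a → e ≢ b → transpose a b e ≡ e
transpose-other a b {e} p q with e ≟ a
... | yes r = ⊥-elim (p r)
... | no _ with e ≟ b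
...   | yes r = ⊥-elim (q r)
...   | no _  = refl

transpose-invol : (a b e : Fin k) → transpose a b (transpose a b e) ≡ e
transpose-invol a b e with e ≟ a
... | yes refl = transpose-b a b
... | no p with e ≟ b
...   | yes refl = transpose-a a b
...   | no q = transpose-other a b p q

-- `Q` is a union of components of the subgraph of the a- and b-edges. A Kempe exchange is valid on
-- any such union, which allows exchanges on the complement of a path.
Closed : Partial n k → Fin k → Fin k → (Fin n → Set) → Set
Closed c a b Q = ∀ {v w e} → e ≡ a ⊎ e ≡ b → Q v → Has c v w e → Q w

module Swap {c : Partial n k} (P : Proper c) (a b : Fin k) {Q : Fin n → Set}
            (Q? : ∀ v → Dec (Q v)) (closed : Closed c a b Q) where

  act : Fin n → Fin k → Fin k
  act v with Q? v
  ... | yes _ = transpose a b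
  ... | no _  = λ e → e

  act-in : ∀ {v} → Q v → ∀ e → act v e ≡ transpose a b e
  act-in {v} q e with Q? v
  ... | yes _ = refl
  ... | no ¬q = ⊥-elim (¬q q)

  act-out : ∀ {v} → ¬ Q v → ∀ e → act v e ≡ e
  act-out {v} ¬q e with Q? v
  ... | yes q = ⊥-elim (¬q q)
  ... | no _  = refl

  act-other : ∀ v {e} → e ≢ a → e ≢ b → act v e ≡ e
  act-other v p q with Q? v
  ... | yes _ = transpose-other a b p q
  ... | no _  = refl

  act-invol : ∀ v e → act v (act v e) ≡ e
  act-invol v e with Q? v
  ... | yes _ = transpose-invol a b e
  ... | no _  = refl

  opaque
    exchange : Partial n k
    exchange v w = Maybe.map (act v) (c v w)

    exchange-map : ∀ v w → exchange v w ≡ Maybe.map (act v) (c v w)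
    exchange-map v w = refl

  opaque
    -- The exchange recolors an ordered pair according to its first vertex; closedness makes the two
    -- orientations agree.
    act-sym : ∀ {v w e} → Has c v w e → act v e ≡ act w e
    act-sym {v} {w} {e} h with e ≟ a | e ≟ b
    ... | no p | no q = trans (act-other v p q) (sym (act-other w p q))
    ... | yes p | _ = lem (inj₁ p)
      where
      lem : e ≡ a ⊎ e ≡ b → act v e ≡ act w e
      lem i with Q? v | Q? w
      ... | yes _ | yes _ = refl
      ... | no _  | no _  = refl
      ... | yes q | no ¬q = ⊥-elim (¬q (closed i q h))
      ... | no ¬q | yes q = ⊥-elim (¬q (closed i q (flip P h)))
    ... | no _ | yes p = lem (inj₂ p)
      where
      lem : e ≡ a ⊎ e ≡ b → act v e ≡ act w e
      lem i with Q? v | Q? w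
      ... | yes _ | yes _ = refl
      ... | no _  | no _  = refl
      ... | yes q | no ¬q = ⊥-elim (¬q (closed i q h))
      ... | no ¬q | yes q = ⊥-elim (¬q (closed i q (flip P h)))

  ex-Has : ∀ {v w e} → Has c v w e → Has exchange v w (act v e)
  ex-Has {v} {w} (has h) = has (trans (exchange-map v w) (cong (Maybe.map (act _)) h))

  ex-Has⁻ : ∀ {v w e} → Has exchange v w e → Has c v w (act v e)
  ex-Has⁻ {v} {w} {e} (has h) = has (go (c v w) refl (trans (sym (exchange-map v w)) h))
    where
    go : ∀ m → c v w ≡ m → Maybe.map (act v) m ≡ just e → c v w ≡ just (act v e)
    go (just f) q r = trans q
      (cong just (trans (sym (act-invol v f)) (cong (act v) (just-injective r))))

  ex-nothing : ∀ {v w} → exchange v w ≡ nothing → c v w ≡ nothing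
  ex-nothing {v} {w} h with c v w | trans (sym (exchange-map v w)) h
  ... | nothing | _ = refl
  ... | just _  | ()

  ex-nothing⁻ : ∀ {v w} → c v w ≡ nothing → exchange v w ≡ nothing
  ex-nothing⁻ {v} {w} h = trans (exchange-map v w) (cong (Maybe.map (act v)) h)

  ex-symm : ∀ u v → exchange u v ≡ exchange v u
  ex-symm u v with c u v in eq
  ... | nothing = trans (ex-nothing⁻ eq) (sym (ex-nothing⁻ (trans (symm P v u) eq)))
  ... | just e  = trans (color≡ (ex-Has (has eq)))
                    (trans (cong just (act-sym (has eq))) (sym (color≡ (ex-Has (flip P (has eq))))))

  opaque
    ex-Proper : Proper exchange
    ex-Proper = record
      { symm  = ex-symm
      ; inj   = λ h h′ → inj P (ex-Has⁻ h) (ex-Has⁻ h′)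
      ; irref = λ u → ex-nothing⁻ (irref P u)
      }

  ex-Misses : ∀ {v e} → Misses c v e → Misses exchange v (act v e)
  ex-Misses {v} {e} m w h = m w (subst (Has c v w) (act-invol v e) (ex-Has⁻ h))

  ex-Misses-in : ∀ {v e} → Q v → Misses c v e → Misses exchange v (transpose a b e)
  ex-Misses-in q m = subst (Misses exchange _) (act-in q _) (ex-Misses m)

  ex-Misses-in-a : ∀ {v} → Q v → Misses c v a → Misses exchange v b
  ex-Misses-in-a q m = subst (Misses exchange _) (transpose-a a b) (ex-Misses-in q m)

  ex-Misses-in-b : ∀ {v} → Q v → Misses c v b → Misses exchange v a
  ex-Misses-in-b q m = subst (Misses exchange _) (transpose-b a b) (ex-Misses-in q m)

  ex-Misses-out : ∀ {v e} → ¬ Q v → Misses c v e → Misses exchange v e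
  ex-Misses-out q m = subst (Misses exchange _) (act-out q _) (ex-Misses m)

  ex-Misses-other : ∀ {v e} → e ≢ a → e ≢ b → Misses c v e → Misses exchange v e
  ex-Misses-other {v} p q m = subst (Misses exchange v) (act-other v p q) (ex-Misses m)

  ex-Has-out : ∀ {v w e} → ¬ Q v → Has c v w e → Has exchange v w e
  ex-Has-out q h = subst (Has exchange _ _) (act-out q _) (ex-Has h)

  ex-Has-in-b : ∀ {v w} → Q v → Has c v w b → Has exchange v w a
  ex-Has-in-b q h = subst (Has exchange _ _) (trans (act-in q _) (transpose-b a b)) (ex-Has h)

  ex-Has-other : ∀ {v w e} → e ≢ a → e ≢ b → Has c v w e → Has exchange v w e
  ex-Has-other {v} p q h = subst (Has exchange _ _) (act-other v p q) (ex-Has h)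

-- Alternating paths

-- In Walk c a b u m v p q, the color to follow from v is p, and q is the color just used;
-- the initial value b of q is the assumption, in most lemmas, that u misses b.
data Walk (c : Partial n k) (a b : Fin k) (u : Fin n) :
          ℕ → Fin n → Fin k → Fin k → Set where
  here : Walk c a b u 0 u a b
  step : ∀ {m v w p q} → Walk c a b u m v p q → Has c v w p → Walk c a b u (suc m) w q p

On : Partial n k → Fin k → Fin k → Fin n → Fin n → Set
On c a b u v = ∃[ m ] ∃[ p ] ∃[ q ] Walk c a b u m v p q

module _ {c : Partial n k} (P : Proper c) {a b : Fin k} {u : Fin n} where

  walk-colors : ∀ {m v p q} → Walk c a b u m v p q → (p ≡ a × q ≡ b) ⊎ (p ≡ b × q ≡ a)
  walk-colors here = inj₁ (refl , refl)
  walk-colors (step w _) with walk-colors w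
  ... | inj₁ (x , y) = inj₂ (y , x)
  ... | inj₂ (x , y) = inj₁ (y , x)

  walk-det : ∀ {m v p q v′ p′ q′} → Walk c a b u m v p q → Walk c a b u m v′ p′ q′ →
             v ≡ v′ × p ≡ p′ × q ≡ q′
  walk-det here here = refl , refl , refl
  walk-det (step w h) (step w′ h′) with walk-det w w′
  ... | refl , refl , refl = inj P h h′ , refl , refl

  walk-stop : ∀ {m v p q m′ v′ p′ q′} → Walk c a b u m v p q → Misses c v p →
              Walk c a b u m′ v′ p′ q′ → m′ ≤ m
  walk-stop w s here = z≤n
  walk-stop w s (step w′ h) with m≤n⇒m<n∨m≡n (walk-stop w s w′)
  ... | inj₁ lt = lt
  ... | inj₂ refl with walk-det w w′
  ...   | refl , refl , refl = ⊥-elim (s _ h)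

  opaque
    -- Of the two colors at v, one continues the walk and the other leads back along its last edge;
    -- at u there is no edge to go back along, since u misses b.
    On-closed : Misses c u b → Closed c a b (On c a b u)
    On-closed mu {v} {w} {e} ab (m , p , q , wk) h with e ≟ p
    ... | yes refl = suc m , q , p , step wk h
    ... | no e≢p = back wk (other (walk-colors wk) ab)
      where
      other : (p ≡ a × q ≡ b) ⊎ (p ≡ b × q ≡ a) → e ≡ a ⊎ e ≡ b → e ≡ q
      other (inj₁ (refl , refl)) (inj₁ x) = ⊥-elim (e≢p x)
      other (inj₁ (refl , refl)) (inj₂ x) = x
      other (inj₂ (refl , refl)) (inj₁ x) = x
      other (inj₂ (refl , refl)) (inj₂ x) = ⊥-elim (e≢p x)
      back : ∀ {m p} → Walk c a b u m v p q → e ≡ q → On c a b u w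
      back here refl = ⊥-elim (mu w h)
      back (step wk′ h′) refl =
        subst (On c a b u) (inj P (flip P h′) h) (_ , _ , _ , wk′)

  On-stops : ∀ {m v p q e} → Walk c a b u m v p q → v ≢ u → e ≡ a ⊎ e ≡ b →
             Misses c v e → Misses c v p
  On-stops here v≢u _ _ = ⊥-elim (v≢u refl)
  On-stops {v = v} {p} {q} {e} wk@(step wk′ h) v≢u ab mv = go (walk-colors wk) ab
    where
    q≢ : e ≢ q
    q≢ refl = mv _ (flip P h)
    go : (p ≡ a × q ≡ b) ⊎ (p ≡ b × q ≡ a) → e ≡ a ⊎ e ≡ b → Misses c v p
    go (inj₁ (refl , _)) (inj₁ refl) = mv
    go (inj₁ (_ , refl)) (inj₂ refl) = ⊥-elim (q≢ refl)
    go (inj₂ (_ , refl)) (inj₁ refl) = ⊥-elim (q≢ refl)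
    go (inj₂ (refl , _)) (inj₂ refl) = mv

  opaque
    -- A vertex other than u was entered by one of the two colors, so if it misses a or b, the walk
    -- stops there. Walks are determined by their length, so two walks that stop have the same
    -- length and the same end.
    On-end-unique : ∀ {v w e f} → On c a b u v → v ≢ u → e ≡ a ⊎ e ≡ b → Misses c v e →
                    On c a b u w → w ≢ u → f ≡ a ⊎ f ≡ b → Misses c w f → v ≡ w
    On-end-unique (_ , _ , _ , x) v≢u e∈ mv (_ , _ , _ , y) w≢u f∈ mw
      with On-stops x v≢u e∈ mv | On-stops y w≢u f∈ mw
    ... | sx | sy with ≤-antisym (walk-stop y sy x) (walk-stop x sx y)
    ...   | refl = proj₁ (walk-det x y)

walk-mono : ∀ {c c′ : Partial n k} {a b u} →
            (∀ {v w e} → e ≡ a ⊎ e ≡ b → Has c v w e → Has c′ v w e) →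
            ∀ {m v p q} → Walk c a b u m v p q → Walk c′ a b u m v p q
walk-mono f here = here
walk-mono {c = c} {a = a} {b} {u} f (step {p = p} wk h) = step (walk-mono f wk) (f (side wk) h)
  where
  side : ∀ {m v p q} → Walk c a b u m v p q → p ≡ a ⊎ p ≡ b
  side wk = proj₁ (both wk)
    where
    both : ∀ {m v p q} → Walk c a b u m v p q → (p ≡ a ⊎ p ≡ b) × (q ≡ a ⊎ q ≡ b)
    both here = inj₁ refl , inj₂ refl
    both (step w _) = proj₂ (both w) , proj₁ (both w)

On-mono : ∀ {c c′ : Partial n k} {a b u v} →
          (∀ {v w e} → e ≡ a ⊎ e ≡ b → Has c v w e → Has c′ v w e) →
          On c a b u v → On c′ a b u v
On-mono f (_ , _ , _ , wk) = _ , _ , _ , walk-mono f wk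

opaque
  complement-closed : ∀ {c : Partial n k} → Proper c → ∀ {a b Q} →
                      Closed c a b Q → Closed c a b (¬_ ∘ Q)
  complement-closed P cl i ¬q h q = ¬q (cl i q (flip P h))

erase-keeps : (c : Partial n k) (u v : Fin n) → ∀ {s t} → c s t ≡ nothing →
              set c u v nothing s t ≡ nothing
erase-keeps c u v {s} {t} h with sameEdge? u v s t
... | yes p = set-on c u v nothing p
... | no ¬p = trans (set-off c u v nothing ¬p) h

-- Fans

-- A branch of a fan from its root to u. `S` confines the branch: a shift along it changes no edge
-- from z to a vertex outside `S`.
data Path (c : Partial n k) (z : Fin n) (S : Fin n → Set) : Fin n → Fin n → ℕ → Set where
  nil  : ∀ {u} → S u → Path c z S u u 0
  cons : ∀ {w v u e m} → S w → Misses c w e → Has c z v e → Path c z S v u m →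
         Path c z S w u (suc m)

path-head : ∀ {c : Partial n k} {z S r u m} → Path c z S r u m → S r
path-head (nil s)        = s
path-head (cons s _ _ _) = s

record Shifted (c : Partial n k) (z r : Fin n) (S : Fin n → Set) (d : Fin k)
               (c* : Partial n k) : Set where
  no-eta-equality
  field
    proper* : Proper c*
    away    : ∀ {v w} → v ≢ z → w ≢ z → c* v w ≡ c v w
    off     : ∀ {w} → ¬ S w → c* z w ≡ c z w
    bare    : ∀ {w} → c* z w ≡ nothing → c z w ≡ nothing × w ≢ r
    center  : ∀ {e} → Misses c z e → e ≢ d → Misses c* z e

open Shifted public

-- The bound N is needed for termination: moving one color can shorten the rest of the path.
opaque
  shift : ∀ N {c : Partial n k} (P : Proper c) {z r u S d m} → m ≤ N → r ≢ z → c r z ≡ nothing →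
          Path c z S r u m → Misses c u d → Misses c z d → ∃[ c* ] Shifted c z r S d c*
  shift N {c} P {z} {r} {d = d} _ r≢z un (nil s) mu mz = put , record
    { proper* = put-Proper
    ; away    = λ v≢z w≢z → set-off c r z (just d) λ { (inj₁ (_ , p)) → w≢z p ; (inj₂ (p , _)) → v≢z p }
    ; off     = λ ¬s → set-off c r z (just d) λ { (inj₁ (p , _)) → r≢z (sym p) ; (inj₂ (_ , refl)) → ¬s s }
    ; bare    = λ h → let h′ , ¬p = put-nothing h in h′ , λ q → ¬p (inj₂ (refl , q))
    ; center  = λ m e≢d → put-Misses e≢d m
    }
    where open Put P r≢z un d mu mz
  shift {n} {k} (suc N) {c} P {z} {r} {u} {S} {d} (s≤s m≤N) r≢z un (cons {v = v} {e = e} {m = l₀} s mr h p) mu mz =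
    finish (reduce (move p))
    where
    z≢v : z ≢ v
    z≢v = Has-≢ P h
    v≢r : v ≢ r
    v≢r refl = nothing-≢ un (flip P h)
    open Erase P z≢v
    open Put erase-Proper r≢z (erase-keeps c z v un) e (erase-Misses mr) (erase-Misses₁ h)
    d≢e : d ≢ e
    d≢e refl = mz _ h
    keepM : ∀ {w f} → f ≢ e → Misses c w f → Misses put w f
    keepM f≢e m = put-Misses f≢e (erase-Misses m)
    un′ : put v z ≡ nothing
    un′ = trans (set-off erase r z (just e) λ { (inj₁ (q , _)) → v≢r q ; (inj₂ (q , _)) → z≢v (sym q) })
            (trans (symm erase-Proper v z) erase-on)
    -- A later step by e leads to v again, as zv is the only e-edge at z. The path is then cut so as
    -- to start at its last such visit, and no remaining step uses e.
    move : ∀ {t l} → Path c z S t u l →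
           (∃[ l′ ] l′ ≤ l × Path put z S t u l′) ⊎ (∃[ l′ ] l′ ≤ l × Path put z S v u l′)
    move (nil x) = inj₁ (_ , ≤-refl , nil x)
    move (cons {v = v′} {e = e′} x m′ h′ q) with move q
    ... | inj₂ (l , le , q′) = inj₂ (l , m≤n⇒m≤1+n le , q′)
    ... | inj₁ (l , le , q′) with e′ ≟ e
    ...   | yes refl = inj₂ (l , m≤n⇒m≤1+n le , subst (λ y → Path put z S y u l) (inj P h′ h) q′)
    ...   | no e′≢e = inj₁ (suc l , s≤s le , cons x (keepM e′≢e m′)
              (put-Has⁻ (erase-Has⁻ (λ { (inj₁ (_ , refl)) → e′≢e (Has-unique h′ h)
                                       ; (inj₂ (q , _)) → z≢v q }) h′)) q′)
    finish : (∃[ l′ ] l′ ≤ l₀ × Path put z S v u l′) → ∃[ c* ] Shifted c z r S d c*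
    finish (l , le , q) with shift N put-Proper (≤-trans le m≤N) (z≢v ∘ sym) un′ q
                           (keepM d≢e mu) (keepM d≢e mz)
    ... | c* , R = c* , record
      { proper* = proper* R
      ; away = λ x≢z y≢z → trans (away R x≢z y≢z)
          (trans (set-off erase r z (just e) λ { (inj₁ (_ , p)) → y≢z p ; (inj₂ (p , _)) → x≢z p })
                 (set-off c z v nothing λ { (inj₁ (p , _)) → x≢z p ; (inj₂ (_ , p)) → y≢z p }))
      ; off = λ ¬s → trans (off R ¬s)
          (trans (set-off erase r z (just e) λ { (inj₁ (p , _)) → r≢z (sym p) ; (inj₂ (_ , refl)) → ¬s s })
                 (set-off c z v nothing λ { (inj₁ (_ , refl)) → ¬s (path-head p) ; (inj₂ (p , _)) → z≢v p }))
      ; bare = λ g → bare′ (bare R g)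
      ; center = λ m f≢d → center R (keepM (λ { refl → m _ h }) m) f≢d
      }
      where
      bare′ : ∀ {w} → put z w ≡ nothing × w ≢ v → c z w ≡ nothing × w ≢ r
      bare′ (g , w≢v) with put-nothing g
      ... | g′ , ¬p with erase-nothing g′
      ...   | inj₁ (inj₁ (_ , q)) = ⊥-elim (w≢v q)
      ...   | inj₁ (inj₂ (q , _)) = ⊥-elim (z≢v q)
      ...   | inj₂ g″ = g″ , λ q → ¬p (inj₂ (refl , q))

-- The vertices of the maximal Vizing fan at z with root r, given by reachability instead of an
-- ordering of the edges.
data Fan (c : Partial n k) (z r : Fin n) : Fin n → Set where
  root : Fan c z r r
  next : ∀ {w v e} → Fan c z r w → Misses c w e → Has c z v e → Fan c z r v

-- A fan grows at its far end, a path at its root; this reversed relation mediates between them.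
data To (c : Partial n k) (z u : Fin n) : Fin n → Set where
  done : To c z u u
  via  : ∀ {w v e} → Misses c w e → Has c z v e → To c z u v → To c z u w

fan-to : ∀ {c : Partial n k} {z r u t} → Fan c z r u → To c z t u → To c z t r
fan-to root t           = t
fan-to (next f m h) t   = fan-to f (via m h t)

opaque
  fan-path : ∀ {c : Partial n k} {z r w u} → Fan c z r w → To c z u w →
             ∃[ m ] Path c z (λ v → Fan c z r v × To c z u v) w u m
  fan-path f done        = _ , nil (f , done)
  fan-path f (via m h t) = _ , cons (f , via m h t) m h (proj₂ (fan-path (next f m h) t))

fan-≢ : ∀ {c : Partial n k} → Proper c → ∀ {z r} → r ≢ z → ∀ {u} → Fan c z r u → u ≢ z
fan-≢ P r≢z root         = r≢z
fan-≢ P r≢z (next _ _ h) = Has-≢ P h ∘ sym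

opaque
  fan-shift : ∀ {c : Partial n k} (P : Proper c) {z r u d} → r ≢ z → c r z ≡ nothing →
              Fan c z r u → Misses c u d → Misses c z d →
              ∃[ c* ] Shifted c z r (λ v → Fan c z r v × To c z u v) d c*
  fan-shift P r≢z un f mu mz with fan-path root (fan-to f done)
  ... | m , p = shift m P ≤-refl r≢z un p mu mz

-- Linkage and elementarity of fans in a graph without a full coloring

module Uncolorable {n k : ℕ} (Adj : Fin n → Fin n → Set)
  (impossible : (c : Partial n k) → Proper c → (∀ {u v} → Adj u v → c u v ≢ nothing) → ⊥) where

  record Near (r z : Fin n) (c : Partial n k) : Set where
    no-eta-equality
    field
      pr   : Proper c
      cov  : ∀ {u v} → Adj u v → c u v ≡ nothing → SameEdge r z u v
      un   : c r z ≡ nothing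
      root≢ : r ≢ z

  open Near public

  Near-flip : ∀ {r z c} → Near r z c → Near z r c
  Near-flip N = record { pr = pr N ; cov = λ a h → SE-comm (cov N a h)
                       ; un = trans (symm (pr N) _ _) (un N) ; root≢ = root≢ N ∘ sym }

  Near-swap : ∀ {r z c} (N : Near r z c) (a b : Fin k) {Q} (Q? : ∀ v → Dec (Q v))
              (cl : Closed c a b Q) → Near r z (Swap.exchange (pr N) a b Q? cl)
  Near-swap N a b Q? cl = record
    { pr = ex-Proper ; cov = λ x h → cov N x (ex-nothing h) ; un = ex-nothing⁻ (un N) ; root≢ = root≢ N }
    where open Swap (pr N) a b Q? cl

  common : ∀ {r z c d} → Near r z c → Misses c r d → Misses c z d → ⊥
  common {d = d} N mr mz = impossible put put-Proper λ x h →
    let h′ , ¬p = put-nothing h in ¬p (cov N x h′)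
    where open Put (pr N) (root≢ N) (un N) d mr mz

  opaque
    -- If the path from r avoided z, an exchange on it would make r miss b as z does, and rz could
    -- take b.
    link : ∀ {r z c a b} → Near r z c → Misses c r a → Misses c z b → ¬ ¬ On c b a r z
    link {r} {z} {c} {a} {b} N mr mz ¬on = ¬¬-decidable (On c b a r) λ Q? →
      let cl = On-closed (pr N) mr
          open Swap (pr N) b a Q? cl
      in common (Near-swap N b a Q? cl) (ex-Misses-in-b (_ , _ , _ , here) mr) (ex-Misses-out ¬on mz)

  opaque
    -- Shifting along the branch to u colors rz, and d is free for the edge zu.
    fan-center : ∀ {r z c u d} → Near r z c → Fan c z r u → Misses c z d → Misses c u d → ⊥
    fan-center {r} {z} {c} N f mz mu with fan-shift (pr N) (root≢ N) (un N) f mu mz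
    ... | c* , R = impossible c* (proper* R) full
      where
      star : ∀ {v} → Adj z v → c* z v ≢ nothing
      star x h with bare R h
      ... | h′ , v≢r with cov N x h′
      ...   | inj₁ (p , _) = root≢ N (sym p)
      ...   | inj₂ (_ , p) = v≢r p
      full : ∀ {u v} → Adj u v → c* u v ≢ nothing
      full {u} {v} x h with u ≟ z | v ≟ z
      ... | yes refl | _ = star x h
      ... | no u≢z | no v≢z with cov N x (trans (sym (away R u≢z v≢z)) h)
      ...   | inj₁ (_ , p) = v≢z p
      ...   | inj₂ (p , _) = u≢z p
      full {u} {v} x h | no u≢z | yes refl with bare R (trans (symm (proper* R) v u) h)
      ... | h′ , u≢r with cov N x (trans (symm (pr N) u v) h′)
      ...   | inj₁ (p , _) = u≢r p
      ...   | inj₂ (p , _) = u≢z p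

  opaque
    -- Otherwise an exchange off the path from z makes u miss d and keeps the edges at z. A step of
    -- the fan is lost only if it leaves by e from a vertex off the path; that vertex then misses d
    -- itself and replaces u in `fan-center`.
    fan-link : ∀ {r z c u d e} → Near r z c → Fan c z r u → Misses c z d → Misses c u e →
               ¬ ¬ On c e d z u
    fan-link {r} {z} {c} {u} {d} {e} N f mz mu ¬on = ¬¬-decidable (On c e d z) λ On? →
      final On? (transfer′ On? f)
      where
      cl : Closed c e d (λ v → ¬ On c e d z v)
      cl = complement-closed (pr N) (On-closed (pr N) mz)
      ex : (∀ v → Dec (On c e d z v)) → Partial n k
      ex On? = Swap.exchange (pr N) e d (λ v → ¬? (On? v)) cl
      z∉ : ¬ ¬ On c e d z z
      z∉ q = q (_ , _ , _ , here)
      Alt : (∀ v → Dec (On c e d z v)) → Fin n → Set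
      Alt On? w = Fan (ex On?) z r w ⊎ (∃[ v ] Fan (ex On?) z r v × Misses (ex On?) v d)
      transfer′ : ∀ On? {w} → Fan c z r w → Alt On? w
      transfer′ On? root = inj₁ root
      transfer′ On? (next {w} {v} {e′} g m h) with transfer′ On? g
      ... | inj₂ x = inj₂ x
      ... | inj₁ g′ with e′ ≟ e
      ...   | no e′≢e = inj₁ (next g′ (ex-Misses-other e′≢e (λ { refl → mz _ h }) m) (ex-Has-out z∉ h))
        where open Swap (pr N) e d (λ v → ¬? (On? v)) cl
      ...   | yes refl with On? w
      ...     | yes q = inj₁ (next g′ (ex-Misses-out (λ ¬q → ¬q q) m) (ex-Has-out z∉ h))
        where open Swap (pr N) e d (λ v → ¬? (On? v)) cl
      ...     | no ¬q = inj₂ (w , g′ , ex-Misses-in-a ¬q m)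
        where open Swap (pr N) e d (λ v → ¬? (On? v)) cl
      final : ∀ On? → Alt On? u → ⊥
      final On? alt = go alt
        where
        open Swap (pr N) e d (λ v → ¬? (On? v)) cl
        N′ : Near r z exchange
        N′ = Near-swap N e d (λ v → ¬? (On? v)) cl
        go : Alt On? u → ⊥
        go (inj₁ g) = fan-center N′ g (ex-Misses-out z∉ mz) (ex-Misses-in-a ¬on mu)
        go (inj₂ (_ , g , m)) = fan-center N′ g (ex-Misses-out z∉ mz) m

  opaque
    -- Both vertices would be the one other end of the (e,d)-path from z.
    fan-elementary : ∀ {r z c u v d e} → Near r z c → Misses c z d → u ≢ v →
                     Fan c z r u → Fan c z r v → Misses c u e → Misses c v e → ⊥
    fan-elementary N mz u≢v fu fv mu mv =
      fan-link N fu mz mu λ ou → fan-link N fv mz mv λ ov →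
      u≢v (On-end-unique (pr N) ou (fan-≢ (pr N) (root≢ N) fu) (inj₁ refl) mu
                                ov (fan-≢ (pr N) (root≢ N) fv) (inj₁ refl) mv)

SE-off : ∀ {n} {z a v w : Fin n} → v ≢ z → v ≢ a → ¬ SameEdge z a v w
SE-off v≢z v≢a (inj₁ (p , _)) = v≢z p
SE-off v≢z v≢a (inj₂ (p , _)) = v≢a p

SE-star : ∀ {n} {z a w : Fin n} → z ≢ a → w ≢ a → ¬ SameEdge z a z w
SE-star z≢a w≢a (inj₁ (_ , p)) = w≢a p
SE-star z≢a w≢a (inj₂ (p , _)) = z≢a p

On-arrive : ∀ {n k} {c : Partial n k} → Proper c → ∀ {a b u v} → On c a b u v → v ≢ u →
            Misses c v a → Misses c v b → ⊥
On-arrive P (_ , _ , _ , here) v≢u _ _ = v≢u refl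
On-arrive P (_ , _ , _ , step w h) _ ma mb with walk-colors P w
... | inj₁ (refl , _) = ma _ (flip P h)
... | inj₂ (refl , _) = mb _ (flip P h)

opaque
  On-least : ∀ {n k} {c : Partial n k} → Proper c → ∀ {a b u Q} → Closed c a b Q → Q u →
             ∀ {v} → On c a b u v → Q v
  On-least {c = c} P {a} {b} {u} {Q} cl qu (_ , _ , _ , wk) = go wk
    where
    go : ∀ {m v p q} → Walk c a b u m v p q → Q v
    go here = qu
    go (step w h) with walk-colors P w
    ... | inj₁ (refl , _) = cl (inj₁ refl) (go w) h
    ... | inj₂ (refl , _) = cl (inj₂ refl) (go w) h

-- Colorings with the edge xy uncolored

module Slide {n k} {x y z : Fin n} {δ : Fin k} (x≢z : x ≢ z) {c : Partial n k} (P : Proper c)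
             (x≢y : x ≢ y) (un : c x y ≡ nothing) (yz : Has c y z δ) (xδ : Misses c x δ) where

  y≢z : y ≢ z
  y≢z = Has-≢ P yz

  open Erase P y≢z
  open Put erase-Proper x≢y (erase-keeps c y z un) δ (erase-Misses xδ) (erase-Misses₁ yz)
    renaming (put to slide; put-Proper to slide-Proper) public

  slide-Misses : ∀ {w e} → w ≢ x → w ≢ y → Misses c w e → Misses slide w e
  slide-Misses w≢x w≢y m = put-Misses-off w≢x w≢y (erase-Misses m)

  slide-Misses-y : ∀ {w e} → e ≢ δ → Misses c w e → Misses slide w e
  slide-Misses-y e≢δ m = put-Misses e≢δ (erase-Misses m)

  slide-center : Misses slide z δ
  slide-center = put-Misses-off (x≢z ∘ sym) (y≢z ∘ sym) (erase-Misses₂ yz)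

  slide-Has : ∀ {s t e} → ¬ SameEdge y z s t → Has c s t e → Has slide s t e
  slide-Has ¬p h = put-Has⁻ (erase-Has⁻ ¬p h)

  slide-xy : ∀ {s t} → SameEdge x y s t → Has slide s t δ
  slide-xy p = has (set-on erase x y (just δ) p)

  slide-cases : ∀ {s t e} → Has slide s t e → (SameEdge x y s t × e ≡ δ) ⊎ (Has c s t e × ¬ SameEdge y z s t)
  slide-cases h with put-Has h
  ... | inj₁ p = inj₁ p
  ... | inj₂ g = inj₂ (erase-Has g)

  slide-un : slide y z ≡ nothing
  slide-un = trans (set-off erase x y (just δ) λ { (inj₁ (p , _)) → x≢y (sym p) ; (inj₂ (_ , p)) → x≢z (sym p) })
                   erase-on

  slide-nothing : ∀ {s t} → slide s t ≡ nothing →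
                  SameEdge y z s t ⊎ (c s t ≡ nothing × ¬ SameEdge x y s t)
  slide-nothing h with put-nothing h
  ... | h′ , ¬p with erase-nothing h′
  ...   | inj₁ q = inj₁ q
  ...   | inj₂ g = inj₂ (g , ¬p)

  slide-nothing⁻ : ∀ {s t} → ¬ SameEdge x y s t → c s t ≡ nothing → slide s t ≡ nothing
  slide-nothing⁻ ¬p g = trans (set-off erase x y (just δ) ¬p) (erase-keeps c y z g)

-- Colors both xy and yz, by δ and q, and so frees δ at z. It is applied after another edge at z has
-- been uncolored to make q free there.
module Reroute {n k} {x y z : Fin n} {δ : Fin k} (x≢z : x ≢ z) {c : Partial n k} (P : Proper c)
             (x≢y : x ≢ y) (un : c x y ≡ nothing) (yz : Has c y z δ) (xδ : Misses c x δ)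
             {q : Fin k} (q≢δ : q ≢ δ) (yq : Misses c y q) (zq : Misses c z q) where

  open Slide x≢z P x≢y un yz xδ
  open Put slide-Proper y≢z slide-un q (slide-Misses-y q≢δ yq)
           (slide-Misses (x≢z ∘ sym) (y≢z ∘ sym) zq)
    using () renaming (put to reroute; put-Proper to rr-Proper; put-Misses to pm;
                       put-Misses-off to pmo; put-Has⁻ to ph; put-nothing to pn) public

  rr-Misses : ∀ {w e} → w ≢ x → w ≢ y → e ≢ q → Misses c w e → Misses reroute w e
  rr-Misses w≢x w≢y e≢q m = pm e≢q (slide-Misses w≢x w≢y m)

  rr-Misses-off : ∀ {w e} → w ≢ x → w ≢ y → w ≢ z → Misses c w e → Misses reroute w e
  rr-Misses-off w≢x w≢y w≢z m = pmo w≢y w≢z (slide-Misses w≢x w≢y m)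

  rr-center : Misses reroute z δ
  rr-center = pm (q≢δ ∘ sym) slide-center

  rr-Has : ∀ {s t e} → ¬ SameEdge y z s t → Has c s t e → Has reroute s t e
  rr-Has ¬p h = ph (slide-Has ¬p h)

  rr-nothing : ∀ {s t} → reroute s t ≡ nothing → c s t ≡ nothing × ¬ SameEdge x y s t
  rr-nothing h with pn h
  ... | h′ , ¬p with slide-nothing h′
  ...   | inj₁ p = ⊥-elim (¬p p)
  ...   | inj₂ g = g

  rr-nothing⁻ : ∀ {s t} → ¬ SameEdge x y s t → ¬ SameEdge y z s t → c s t ≡ nothing → reroute s t ≡ nothing
  rr-nothing⁻ ¬p ¬q g = trans (set-off slide y z (just q) ¬q) (slide-nothing⁻ ¬p g)

module Kites {n k : ℕ} (Adj : Fin n → Fin n → Set)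
  (impossible : (c : Partial n k) → Proper c → (∀ {u v} → Adj u v → c u v ≢ nothing) → ⊥)
  (x y z : Fin n) (δ : Fin k) (x≢z : x ≢ z) where

  open Uncolorable {n} {k} Adj impossible

  record Kite (c : Partial n k) : Set where
    no-eta-equality
    field
      near : Near x y c
      yz   : Has c y z δ
      xδ   : Misses c x δ

  -- What carries a branch of the broom over to a fan of ψ with root ρ: the vertices other than x
  -- and y lose no missing color, and the edges at z, except those to y and ρ, keep their colors.
  record Keeps (c ψ : Partial n k) (ρ : Fin n) : Set where
    no-eta-equality
    field
      k-miss : ∀ {w e} → w ≢ x → w ≢ y → Misses c w e → Misses ψ w e
      k-edge : ∀ {w e} → w ≢ y → w ≢ ρ → Has c z w e → Has ψ z w e

  open Keeps public

  -- Not extending by b makes the tree survive an exchange of b with a color p whenever no vertex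
  -- used for an extension misses p.
  data Tree (c : Partial n k) (b r : Fin k) : Fin n → Set where
    top : ∀ {v} → v ≢ x → v ≢ y → Has c z v r → Tree c b r v
    ext : ∀ {w v e} → Tree c b r w → Misses c w e → e ≢ b → v ≢ x → v ≢ y → Has c z v e →
          Tree c b r v

  tree-≢x : ∀ {c b r v} → Tree c b r v → v ≢ x
  tree-≢x (top p _ _)         = p
  tree-≢x (ext _ _ _ p _ _) = p

  tree-≢y : ∀ {c b r v} → Tree c b r v → v ≢ y
  tree-≢y (top _ p _)         = p
  tree-≢y (ext _ _ _ _ p _) = p

  tree-edge : ∀ {c b r v} → Tree c b r v → ∃[ e ] Has c z v e
  tree-edge (top _ _ h)         = _ , h
  tree-edge (ext _ _ _ _ _ h) = _ , h

  opaque
    tree-top : ∀ {c b r v} → Tree c b r v → ∃[ t ] t ≢ x × t ≢ y × Has c z t r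
    tree-top (top p q h)         = _ , p , q , h
    tree-top (ext t _ _ _ _ _) = tree-top t

  tree-fan : ∀ {c ψ ρ b r} → Proper c → Keeps c ψ ρ → ∀ {t} → Has c z t r → Fan ψ z ρ t →
             ∀ {v} → Tree c b r v → Fan ψ z ρ v
  tree-fan P K h f (top _ _ h′) = subst (Fan _ _ _) (inj P h h′) f
  tree-fan {ρ = ρ} P K h f {v} (ext {w} {e = e} t m _ _ v≢y h′) with v ≟ ρ
  -- The edge zρ may have changed its color or lost it, but ρ is the root.
  ... | yes refl = root
  ... | no v≢ρ = next (tree-fan P K h f t) (k-miss K (tree-≢x t) (tree-≢y t) m) (k-edge K v≢y v≢ρ h′)

  module Basic {c} (K : Kite c) where

    open Kite K public
    open Near near public using () renaming (pr to P; un to un-xy; root≢ to x≢y; cov to cov-xy)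

    y≢z : y ≢ z
    y≢z = Has-≢ P yz

    z≢x : z ≢ x
    z≢x = x≢z ∘ sym

    z≢y : z ≢ y
    z≢y = y≢z ∘ sym

    -- This fan is centered at y, not at z; it separates the colors missing at z from those missing
    -- at x and y.
    fan-z : Fan c y x z
    fan-z = next root xδ yz

    yz-disjoint : ∀ {e} → Misses c y e → Misses c z e → ⊥
    yz-disjoint = fan-center near fan-z

    xz-disjoint : ∀ {b e} → Misses c y b → Misses c x e → Misses c z e → ⊥
    xz-disjoint yb mx mz = fan-elementary near yb x≢z root fan-z mx mz

    open Slide x≢z P x≢y un-xy yz xδ public
      using (slide; slide-Proper; slide-Misses; slide-Misses-y; slide-center; slide-Has;
             slide-xy; slide-cases; slide-un; slide-nothing)

    opaque
      slid-near : Near y z slide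
      slid-near = record { pr = slide-Proper ; cov = cov′ ; un = slide-un ; root≢ = y≢z }
        where
        cov′ : ∀ {u v} → Adj u v → slide u v ≡ nothing → SameEdge y z u v
        cov′ a h with slide-nothing h
        ... | inj₁ p = p
        ... | inj₂ (g , ¬p) = ⊥-elim (¬p (cov-xy a g))

    opaque
      slid-keeps : Keeps c slide y
      slid-keeps = record
        { k-miss = slide-Misses
        ; k-edge = λ w≢y _ → slide-Has λ { (inj₁ (p , _)) → z≢y p ; (inj₂ (_ , p)) → w≢y p } }

    colour-≢δ : ∀ {v r} → v ≢ y → Has c z v r → r ≢ δ
    colour-≢δ v≢y h refl = v≢y (inj P h (flip P yz))

    slid-fan : ∀ {b r v} → Misses c y r → Tree c b r v → Fan slide z y v
    slid-fan {r = r} m t with tree-top t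
    ... | t₀ , _ , t₀≢y , h = tree-fan P slid-keeps h
      (next root (slide-Misses-y (colour-≢δ t₀≢y h) m) (k-edge slid-keeps t₀≢y t₀≢y h)) t

  -- The path from y avoids z. `same₀` allows alternating paths in colors other than q and b to be
  -- compared in c and c₀.
  record Type₀ (c : Partial n k) (q b : Fin k) (c₀ : Partial n k) : Set where
    no-eta-equality
    field
      kite₀  : Kite c₀
      y-q    : Misses c₀ y q
      x-b    : Misses c₀ x b
      x-keep : ∀ {e} → e ≢ q → Misses c x e → Misses c₀ x e
      keeps₀ : Keeps c c₀ y
      same₀  : ∀ {v w e} → e ≢ q → e ≢ b → Has c v w e → Has c₀ v w e

  -- The path meets z through its q-edge zu₀, which becomes the uncolored edge, while xy and yz take
  -- δ and q. `u₀-¬b` holds because the path enters u₀ by a b-edge; it distinguishes u₀ from the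
  -- vertices that miss b in c.
  record Typeβ (c : Partial n k) (u₀ : Fin n) (b : Fin k) (ψ : Partial n k) : Set where
    no-eta-equality
    field
      nearβ  : Near u₀ z ψ
      keepsβ : Keeps c ψ u₀
      z-δ    : Misses ψ z δ
      u₀-b   : Misses ψ u₀ b
      u₀-¬b  : ¬ Misses c u₀ b

  -- The path meets z through its b-edge zw₀, which becomes the uncolored edge, while xy takes q.
  -- This frees b at z and leaves δ on yz; the last fields are kept for a further recoloring.
  record Typeα (c : Partial n k) (q b : Fin k) (ψ : Partial n k) (w₀ : Fin n) : Set where
    no-eta-equality
    field
      edgeα  : Has c z w₀ b
      w₀≢x   : w₀ ≢ x
      w₀≢y   : w₀ ≢ y
      nearα  : Near w₀ z ψ
      keepsα : Keeps c ψ w₀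
      z-b    : Misses ψ z b
      w₀-q   : Misses ψ w₀ q
      x-keep : ∀ {e} → e ≢ q → Misses c x e → Misses ψ x e
      xyα    : Has ψ x y q
      yzα    : Has ψ y z δ

  -- Instead of the first visit to z, the cases are separated by the path Q of the coloring c⁻
  -- without zu₀ and zw₀. It avoids z, and its second end u₀ or w₀, if any, is where the path
  -- from y in c meets z.
  module Types {c} (K : Kite c) {q b} (xq : Misses c x q) (q≢δ : q ≢ δ) (yb : Misses c y b)
               {u₀ w₀} (hu : Has c z u₀ q) (hw : Has c z w₀ b) where

    open Basic K

    q≢b : q ≢ b
    q≢b refl = common near xq yb

    δ≢q : δ ≢ q
    δ≢q = q≢δ ∘ sym

    δ≢b : δ ≢ b
    δ≢b refl = common near xδ yb

    u₀≢x : u₀ ≢ x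
    u₀≢x refl = xq z (flip P hu)

    u₀≢y : u₀ ≢ y
    u₀≢y refl = q≢δ (Has-unique (flip P hu) yz)

    w₀≢y′ : w₀ ≢ y
    w₀≢y′ refl = yb z (flip P hw)

    u₀≢w₀ : u₀ ≢ w₀
    u₀≢w₀ refl = q≢b (Has-unique hu hw)

    z≢u₀ : z ≢ u₀
    z≢u₀ = Has-≢ P hu

    z≢w₀ : z ≢ w₀
    z≢w₀ = Has-≢ P hw

    module EU = Erase P z≢u₀
    module EW = Erase P z≢w₀
    module E2 = Erase EU.erase-Proper z≢w₀

    c⁻ : Partial n k
    c⁻ = E2.erase

    m⁻ : ∀ {w e} → Misses c w e → Misses c⁻ w e
    m⁻ m = E2.erase-Misses (EU.erase-Misses m)

    hw′ : Has EU.erase z w₀ b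
    hw′ = EU.erase-Has⁻ (SE-star z≢u₀ (u₀≢w₀ ∘ sym)) hw

    zq⁻ : Misses c⁻ z q
    zq⁻ = E2.erase-Misses (EU.erase-Misses₁ hu)

    zb⁻ : Misses c⁻ z b
    zb⁻ = E2.erase-Misses₁ hw′

    uq⁻ : Misses c⁻ u₀ q
    uq⁻ = E2.erase-Misses (EU.erase-Misses₂ hu)

    wb⁻ : Misses c⁻ w₀ b
    wb⁻ = E2.erase-Misses₂ hw′

    Q : Fin n → Set
    Q = On c⁻ q b y

    yQ : Q y
    yQ = _ , _ , _ , here

    arrive : ∀ {v} → Q v → v ≢ y → Misses c⁻ v q → Misses c⁻ v b → ⊥
    arrive = On-arrive E2.erase-Proper

    z∉ : ¬ Q z
    z∉ qz = arrive qz z≢y zq⁻ zb⁻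

    Q≢z : ∀ {v} → Q v → v ≢ z
    Q≢z qv refl = z∉ qv

    closed⁻ : Closed c⁻ q b Q
    closed⁻ = On-closed E2.erase-Proper (m⁻ yb)

    ends : ∀ {v w e f} → Q v → v ≢ y → e ≡ q ⊎ e ≡ b → Misses c⁻ v e →
           Q w → w ≢ y → f ≡ q ⊎ f ≡ b → Misses c⁻ w f → v ≡ w
    ends = On-end-unique E2.erase-Proper

    module Case₀ (Q? : ∀ v → Dec (Q v)) (¬u : ¬ Q u₀) (¬w : ¬ Q w₀) where

      closed : Closed c q b Q
      closed i qv h = closed⁻ i qv
        (E2.erase-Has⁻ (SE-off (Q≢z qv) λ { refl → ¬w qv })
          (EU.erase-Has⁻ (SE-off (Q≢z qv) λ { refl → ¬u qv }) h))

      open Swap P q b Q? closed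

      off-Q : ∀ {w e} → Q x → e ≡ q ⊎ e ≡ b → w ≢ x → w ≢ y → Misses c w e → ¬ Q w
      off-Q qx i w≢x w≢y m qw = w≢x (ends qw w≢y i (m⁻ m) qx x≢y (inj₁ refl) (m⁻ xq))

      keep : ∀ {w e} → Q x → w ≢ x → w ≢ y → Misses c w e → Misses exchange w e
      keep {w} {e} qx w≢x w≢y m with e ≟ q | e ≟ b
      ... | yes p | _ = ex-Misses-out (off-Q qx (inj₁ p) w≢x w≢y m) m
      ... | no _ | yes p = ex-Misses-out (off-Q qx (inj₂ p) w≢x w≢y m) m
      ... | no p | no p′ = ex-Misses-other p p′ m

      opaque
        case₀ : (∀ c₀ → Type₀ c q b c₀ → ⊥) → ⊥
        -- Linkage puts x on the path from y; being the second end, it receives b, and no other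
        -- vertex of the path misses q or b.
        case₀ κ = link (Near-flip near) yb xq λ ox → let qx = On-least P closed yQ ox in
          κ exchange record
            { kite₀ = record { near = Near-swap near q b Q? closed
                             ; yz = ex-Has-other δ≢q δ≢b yz
                             ; xδ = ex-Misses-other δ≢q δ≢b xδ }
            ; y-q = ex-Misses-in-b yQ yb
            ; x-b = ex-Misses-in-a qx xq
            ; x-keep = λ e≢q m → ex-Misses-other e≢q (λ { refl → common near m yb }) m
            ; keeps₀ = record { k-miss = keep qx ; k-edge = λ _ _ → ex-Has-out z∉ }
            ; same₀ = ex-Has-other }

    module Caseβ (Q? : ∀ v → Dec (Q v)) (qu : Q u₀) where

      ¬w : ¬ Q w₀
      ¬w qw = u₀≢w₀ (ends qu u₀≢y (inj₁ refl) uq⁻ qw w₀≢y′ (inj₂ refl) wb⁻)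

      closed : Closed EU.erase q b Q
      closed i qv h = closed⁻ i qv (E2.erase-Has⁻ (SE-off (Q≢z qv) λ { refl → ¬w qv }) h)

      open Swap EU.erase-Proper q b Q? closed

      ¬b : ¬ Misses c u₀ b
      ¬b m = arrive qu u₀≢y uq⁻ (m⁻ m)

      off-Q : ∀ {w e} → e ≡ q ⊎ e ≡ b → w ≢ y → Misses c w e → ¬ Q w
      off-Q i w≢y m qw with ends qw w≢y i (m⁻ m) qu u₀≢y (inj₁ refl) uq⁻
      off-Q (inj₁ refl) _ m _ | refl = m z (flip P hu)
      off-Q (inj₂ refl) _ m _ | refl = ¬b m

      keep : ∀ {w e} → w ≢ y → Misses c w e → Misses exchange w e
      keep {w} {e} w≢y m with e ≟ q | e ≟ b
      ... | yes p | _ = ex-Misses-out (off-Q (inj₁ p) w≢y m) (EU.erase-Misses m)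
      ... | no _ | yes p = ex-Misses-out (off-Q (inj₂ p) w≢y m) (EU.erase-Misses m)
      ... | no p | no p′ = ex-Misses-other p p′ (EU.erase-Misses m)

      -- The exchange frees q at y, and uncoloring zu₀ frees it at z, so yz can take q once xy has
      -- taken δ.
      module R = Reroute x≢z ex-Proper x≢y (ex-nothing⁻ {x} {y} (erase-keeps c z u₀ un-xy))
        (ex-Has-other δ≢q δ≢b (EU.erase-Has⁻ (SE-off y≢z (u₀≢y ∘ sym)) yz))
        (ex-Misses-other δ≢q δ≢b (EU.erase-Misses xδ)) q≢δ
        (ex-Misses-in-b yQ (EU.erase-Misses yb)) (ex-Misses-out z∉ (EU.erase-Misses₁ hu))

      keep′ : ∀ {w e} → w ≢ x → w ≢ y → Misses c w e → Misses R.reroute w e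
      keep′ {w} w≢x w≢y m with w ≟ z
      ... | no w≢z = R.rr-Misses-off w≢x w≢y w≢z (keep w≢y m)
      ... | yes refl = R.rr-Misses w≢x w≢y (λ { refl → m _ hu }) (keep w≢y m)

      opaque
        caseβ : (∀ ψ → Typeβ c u₀ b ψ → ⊥) → ⊥
        caseβ κ = κ R.reroute record
          { nearβ = record { pr = R.rr-Proper ; cov = cov′
                           ; un = R.rr-nothing⁻ (SE-off u₀≢x u₀≢y) (SE-off u₀≢y (z≢u₀ ∘ sym))
                               (ex-nothing⁻ {u₀} {z} (trans (symm EU.erase-Proper u₀ z) EU.erase-on))
                           ; root≢ = z≢u₀ ∘ sym }
          ; keepsβ = record
              { k-miss = keep′
              ; k-edge = λ w≢y w≢u₀ h → R.rr-Has (λ { (inj₁ (p , _)) → z≢y p ; (inj₂ (_ , p)) → w≢y p })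
                  (ex-Has-out z∉ (EU.erase-Has⁻ (SE-star z≢u₀ w≢u₀) h)) }
          ; z-δ = R.rr-center
          ; u₀-b = R.rr-Misses-off u₀≢x u₀≢y (z≢u₀ ∘ sym) (ex-Misses-in-a qu (EU.erase-Misses₂ hu))
          ; u₀-¬b = ¬b }
          where
          cov′ : ∀ {s t} → Adj s t → R.reroute s t ≡ nothing → SameEdge u₀ z s t
          cov′ {s} {t} a h with R.rr-nothing h
          ... | g , ¬p with EU.erase-nothing (ex-nothing {s} {t} g)
          ...   | inj₁ p = SE-comm p
          ...   | inj₂ g′ = ⊥-elim (¬p (cov-xy a g′))

    module Caseα (Q? : ∀ v → Dec (Q v)) (¬u : ¬ Q u₀) (qw : Q w₀) where

      closed : Closed EW.erase q b Q
      closed i qv h = closed⁻ i qv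
        (E2.erase-Has⁻ (proj₂ (EW.erase-Has h))
          (EU.erase-Has⁻ (SE-off (Q≢z qv) λ { refl → ¬u qv }) (proj₁ (EW.erase-Has h))))

      open Swap EW.erase-Proper q b Q? closed

      off-Q : ∀ {w e} → e ≡ q ⊎ e ≡ b → w ≢ y → Misses c w e → ¬ Q w
      off-Q i w≢y m qw′ with ends qw′ w≢y i (m⁻ m) qw w₀≢y′ (inj₂ refl) wb⁻
      off-Q (inj₁ refl) _ m _ | refl = arrive qw w₀≢y′ (m⁻ m) wb⁻
      off-Q (inj₂ refl) _ m _ | refl = m z (flip P hw)

      keep : ∀ {w e} → w ≢ y → Misses c w e → Misses exchange w e
      keep {w} {e} w≢y m with e ≟ q | e ≟ b
      ... | yes p | _ = ex-Misses-out (off-Q (inj₁ p) w≢y m) (EW.erase-Misses m)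
      ... | no _ | yes p = ex-Misses-out (off-Q (inj₂ p) w≢y m) (EW.erase-Misses m)
      ... | no p | no p′ = ex-Misses-other p p′ (EW.erase-Misses m)

      w₀≢x′ : w₀ ≢ x
      w₀≢x′ refl = off-Q (inj₁ refl) x≢y xq qw

      -- The second end of Q is w₀, so x lies off Q and still misses q, which the exchange has freed
      -- at y.
      open Put ex-Proper x≢y (ex-nothing⁻ {x} {y} (erase-keeps c z w₀ un-xy)) q (keep x≢y xq)
               (ex-Misses-in-b yQ (EW.erase-Misses yb))

      opaque
        caseα : (∀ ψ w₀ → Typeα c q b ψ w₀ → ⊥) → ⊥
        caseα κ = κ put w₀ record
          { edgeα = hw ; w₀≢x = w₀≢x′ ; w₀≢y = w₀≢y′
          ; nearα = record { pr = put-Proper ; cov = cov′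
              ; un = trans (set-off exchange x y (just q) (SE-off w₀≢x′ w₀≢y′))
                       (ex-nothing⁻ {w₀} {z} (trans (symm EW.erase-Proper w₀ z) EW.erase-on))
              ; root≢ = z≢w₀ ∘ sym }
          ; keepsα = record { k-miss = λ w≢x w≢y m → put-Misses-off w≢x w≢y (keep w≢y m)
                            ; k-edge = λ w≢y w≢w₀ h → put-Has⁻ (ex-Has-out z∉ (EW.erase-Has⁻ (SE-star z≢w₀ w≢w₀) h)) }
          ; z-b = put-Misses-off z≢x z≢y (ex-Misses-out z∉ (EW.erase-Misses₁ hw))
          ; w₀-q = put-Misses-off w₀≢x′ w₀≢y′ (ex-Misses-in-b qw (EW.erase-Misses₂ hw))
          ; x-keep = λ e≢q m → put-Misses e≢q (keep x≢y m)
          ; xyα = put-on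
          ; yzα = put-Has⁻ (ex-Has-other δ≢q δ≢b (EW.erase-Has⁻ (SE-off y≢z (w₀≢y′ ∘ sym)) yz)) }
          where
          cov′ : ∀ {s t} → Adj s t → put s t ≡ nothing → SameEdge w₀ z s t
          cov′ {s} {t} a h with put-nothing h
          ... | g , ¬p with EW.erase-nothing (ex-nothing {s} {t} g)
          ...   | inj₁ p = SE-comm p
          ...   | inj₂ g′ = ⊥-elim (¬p (cov-xy a g′))

    opaque
      cases : (∀ c₀ → Type₀ c q b c₀ → ⊥) → (∀ ψ → Typeβ c u₀ b ψ → ⊥) →
              (∀ ψ w₀ → Typeα c q b ψ w₀ → ⊥) → ⊥
      cases κ₀ κβ κα = ¬¬-decidable Q λ Q? → go Q? (Q? u₀) (Q? w₀)
        where
        go : (∀ v → Dec (Q v)) → Dec (Q u₀) → Dec (Q w₀) → ⊥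
        go Q? (yes qu) _       = Caseβ.caseβ Q? qu κβ
        go Q? (no ¬u) (yes qw) = Caseα.caseα Q? ¬u qw κα
        go Q? (no ¬u) (no ¬w)  = Case₀.case₀ Q? ¬u ¬w κ₀

  opaque
    types : ∀ {c} → Kite c → ∀ {q b} → Misses c x q → q ≢ δ → Misses c y b → ∀ {u₀} → Has c z u₀ q →
            (∀ c₀ → Type₀ c q b c₀ → ⊥) → (∀ ψ → Typeβ c u₀ b ψ → ⊥) →
            (∀ ψ w₀ → Typeα c q b ψ w₀ → ⊥) → ⊥
    types K xq q≢δ yb hu κ₀ κβ κα =
      -- A b-edge exists at z, since y misses b and shares no missing color with z.
      Basic.yz-disjoint K yb λ w hw → Types.cases K xq q≢δ yb hu hw κ₀ κβ κα

-- Branches of the broom as fans at z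

module Trees {n k : ℕ} (Adj : Fin n → Fin n → Set)
  (impossible : (c : Partial n k) → Proper c → (∀ {u v} → Adj u v → c u v ≢ nothing) → ⊥)
  (x y z : Fin n) (δ : Fin k) (x≢z : x ≢ z) where

  open Uncolorable {n} {k} Adj impossible
  open Kites {n} {k} Adj impossible x y z δ x≢z

  Seen : Partial n k → Fin k → Set
  Seen c e = Misses c x e ⊎ Misses c y e

  colours-≢ : ∀ {c} → Kite c → ∀ {q b} → Misses c x q → Misses c y b → q ≢ b
  colours-≢ K xq yb refl = common (Kite.near K) xq yb

  tree-≢z : ∀ {c} → Kite c → ∀ {b r v} → Tree c b r v → v ≢ z
  tree-≢z K t with tree-edge t
  ... | _ , h = Has-≢ (Basic.P K) h ∘ sym

  keeps-trans : ∀ {c c₀ ψ} → Keeps c c₀ y → Keeps c₀ ψ y → Keeps c ψ y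
  keeps-trans K L = record
    { k-miss = λ w≢x w≢y m → k-miss L w≢x w≢y (k-miss K w≢x w≢y m)
    ; k-edge = λ w≢y p h → k-edge L w≢y p (k-edge K w≢y p h) }

  tree-keep : ∀ {c c₀} → Keeps c c₀ y → ∀ {b r v} → Tree c b r v → Tree c₀ b r v
  tree-keep K (top p q h) = top p q (k-edge K q q h)
  tree-keep K (ext t m e≢b p q h) =
    ext (tree-keep K t) (k-miss K (tree-≢x t) (tree-≢y t) m) e≢b p q (k-edge K q q h)

  -- Reduces statements about a single tree to fans at z: whatever the type, `tree-fan` then places
  -- the whole tree above zt in the fan of ψ.
  cover : ∀ {c} → Kite c → ∀ {r b} → Seen c r → Misses c y b → ∀ {t} → t ≢ y → Has c z t r →
          (∀ ψ ρ d → Near ρ z ψ → Keeps c ψ ρ → Misses ψ z d → Fan ψ z ρ t → ⊥) → ⊥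
  cover {c} K {r} {b} (inj₂ m) yb {t} t≢y h κ = κ slide y δ slid-near slid-keeps slide-center
    (next root (slide-Misses-y (colour-≢δ t≢y h) m) (k-edge slid-keeps t≢y t≢y h))
    where open Basic K
  cover {c} K {r} {b} (inj₁ m) yb {t} t≢y h κ = types K m (Basic.colour-≢δ K t≢y h) yb h type₀ typeβ typeα
    where
    type₀ : ∀ c₀ → Type₀ c r b c₀ → ⊥
    type₀ c₀ T = κ slide y δ slid-near (keeps-trans keeps₀ slid-keeps) slide-center
      (next root (slide-Misses-y (colour-≢δ t≢y h₀) y-q) (k-edge slid-keeps t≢y t≢y h₀))
      where
      open Type₀ T
      open Basic kite₀
      h₀ = k-edge keeps₀ t≢y t≢y h
    typeβ : ∀ ψ → Typeβ c t b ψ → ⊥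
    typeβ ψ T = κ ψ t δ nearβ keepsβ z-δ root
      where open Typeβ T
    typeα : ∀ ψ w₀ → Typeα c r b ψ w₀ → ⊥
    typeα ψ w₀ T = κ ψ w₀ b nearα keepsα z-b fan
      where
      open Typeα T
      fan : Fan ψ z w₀ t
      fan with t ≟ w₀
      ... | yes refl = root
      ... | no t≢w₀ = next root w₀-q (k-edge keepsα t≢y t≢w₀ h)

  tree-center : ∀ {c} → Kite c → ∀ {r b a v e} → Seen c r → Misses c y b → Tree c a r v →
                Misses c v e → Misses c z e → ⊥
  tree-center K seen yb t mv mz with tree-top t
  ... | _ , _ , t₀≢y , h = cover K seen yb t₀≢y h λ ψ ρ d N keeps zd fan →
    fan-center N (tree-fan (Basic.P K) keeps h fan t)
      (k-miss keeps (Basic.z≢x K) (Basic.z≢y K) mz) (k-miss keeps (tree-≢x t) (tree-≢y t) mv)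

  same-tree : ∀ {c} → Kite c → ∀ {r b a u v e} → Seen c r → Misses c y b → u ≢ v →
              Tree c a r u → Tree c a r v → Misses c u e → Misses c v e → ⊥
  same-tree K seen yb u≢v tu tv mu mv with tree-top tu
  ... | _ , _ , t₀≢y , h = cover K seen yb t₀≢y h λ ψ ρ d N keeps zd fan →
    fan-elementary N zd u≢v (tree-fan (Basic.P K) keeps h fan tu) (tree-fan (Basic.P K) keeps h fan tv)
      (k-miss keeps (tree-≢x tu) (tree-≢y tu) mu) (k-miss keeps (tree-≢x tv) (tree-≢y tv) mv)

  y-trees : ∀ {c} → Kite c → ∀ {r s a u v e} → Misses c y r → Misses c y s → u ≢ v →
            Tree c a r u → Tree c a s v → Misses c u e → Misses c v e → ⊥
  y-trees K yr ys u≢v tu tv mu mv =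
    fan-elementary slid-near slide-center u≢v (slid-fan yr tu) (slid-fan ys tv)
      (slide-Misses (tree-≢x tu) (tree-≢y tu) mu) (slide-Misses (tree-≢x tv) (tree-≢y tv) mv)
    where open Basic K

  -- After the slide y is the root of the fan that contains u, and it still misses b.
  y-tree : ∀ {c} → Kite c → ∀ {r b a u} → Misses c y r → Misses c y b → Tree c a r u → Misses c u b → ⊥
  y-tree K yr yb t m =
    fan-elementary slid-near slide-center (tree-≢y t ∘ sym) root (slid-fan yr t)
      (slide-Misses-y (λ { refl → common near xδ yb }) yb) (slide-Misses (tree-≢x t) (tree-≢y t) m)
    where open Basic K

  -- If the path from y meets z, one fan contains both trees. If not, the trees lie in fans of two
  -- slid colorings that agree on the colors p and δ; w and v would both end the same (p,δ)-path
  -- from z.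
  xy-trees : ∀ {c} → Kite c → ∀ {q b a w v p} → Misses c x q → Misses c y b → p ≢ q → p ≢ b → w ≢ v →
             Tree c a b w → Tree c a q v → Misses c w p → Misses c v p → ⊥
  xy-trees {c} K {q} {b} {a} {w} {v} {p} xq yb p≢q p≢b w≢v tw tv mw mv
    with tree-top tv | tree-top tw
  ... | u₀ , u₀≢x , u₀≢y , hu | w₁ , _ , w₁≢y , hw = types K xq q≢δ yb hu type₀ typeβ typeα
    where
    q≢δ = Basic.colour-≢δ K u₀≢y hu
    both : ∀ {ψ ρ d} → Near ρ z ψ → Keeps c ψ ρ → Misses ψ z d → Fan ψ z ρ w₁ → Fan ψ z ρ u₀ → ⊥
    both N keeps zd fw fu = fan-elementary N zd w≢v
      (tree-fan (Basic.P K) keeps hw fw tw) (tree-fan (Basic.P K) keeps hu fu tv)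
      (k-miss keeps (tree-≢x tw) (tree-≢y tw) mw) (k-miss keeps (tree-≢x tv) (tree-≢y tv) mv)
    type₀ : ∀ c₀ → Type₀ c q b c₀ → ⊥
    type₀ c₀ T =
      fan-link A.slid-near (A.slid-fan yb tw) A.slide-center (A.slide-Misses (tree-≢x tw) (tree-≢y tw) mw) λ ow →
      fan-link B.slid-near (B.slid-fan y-q (tree-keep keeps₀ tv)) B.slide-center mv₀ λ ov →
      w≢v (On-end-unique B.slide-Proper (On-mono transfer ow) (tree-≢z K tw) (inj₁ refl) mw₀
                                        ov (tree-≢z K tv) (inj₁ refl) mv₀)
      where
      open Type₀ T
      module A = Basic K
      module B = Basic kite₀
      mw₀ = B.slide-Misses (tree-≢x tw) (tree-≢y tw) (k-miss keeps₀ (tree-≢x tw) (tree-≢y tw) mw)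
      mv₀ = B.slide-Misses (tree-≢x tv) (tree-≢y tv) (k-miss keeps₀ (tree-≢x tv) (tree-≢y tv) mv)
      off-q : ∀ {e} → e ≡ p ⊎ e ≡ δ → e ≢ q
      off-q (inj₁ refl) = p≢q
      off-q (inj₂ refl) = q≢δ ∘ sym
      off-b : ∀ {e} → e ≡ p ⊎ e ≡ δ → e ≢ b
      off-b (inj₁ refl) = p≢b
      off-b (inj₂ refl) refl = common A.near A.xδ yb
      transfer : ∀ {s t e} → e ≡ p ⊎ e ≡ δ → Has A.slide s t e → Has B.slide s t e
      transfer i h with A.slide-cases h
      ... | inj₁ (se , refl) = B.slide-xy se
      ... | inj₂ (g , ¬se) = B.slide-Has ¬se (same₀ (off-q i) (off-b i) g)
    typeβ : ∀ ψ → Typeβ c u₀ b ψ → ⊥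
    typeβ ψ T = both nearβ keepsβ z-δ fan root
      where
      open Typeβ T
      fan : Fan ψ z u₀ w₁
      fan with w₁ ≟ u₀
      ... | yes refl = root
      ... | no p = next root u₀-b (k-edge keepsβ w₁≢y p hw)
    typeα : ∀ ψ w₀ → Typeα c q b ψ w₀ → ⊥
    typeα ψ w₀ T = both nearα keepsα z-b (subst (Fan ψ z w₀) (inj (Basic.P K) edgeα hw) root) fan
      where
      open Typeα T
      fan : Fan ψ z w₀ u₀
      fan with u₀ ≟ w₀
      ... | yes refl = root
      ... | no p = next root w₀-q (k-edge keepsα u₀≢y p hu)

  -- In the other two types the fan contains u, which misses b, and b is missing a second time: at
  -- the root u₀, or at the center z.
  x-tree-type₀ : ∀ {c} → Kite c → ∀ {q b a u} → Misses c x q → Misses c y b → Tree c a q u → Misses c u b →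
                 (∀ c₀ → Type₀ c q b c₀ → ⊥) → ⊥
  x-tree-type₀ {c} K {q} {b} {a} {u} xq yb t m κ with tree-top t
  ... | u₀ , _ , u₀≢y , hu = types K xq (Basic.colour-≢δ K u₀≢y hu) yb hu κ typeβ typeα
    where
    typeβ : ∀ ψ → Typeβ c u₀ b ψ → ⊥
    typeβ ψ T = fan-elementary {u = u} {v = u₀} nearβ z-δ (λ { refl → u₀-¬b m })
        (tree-fan (Basic.P K) keepsβ hu root t) root (k-miss keepsβ (tree-≢x t) (tree-≢y t) m) u₀-b
      where open Typeβ T
    typeα : ∀ ψ w₀ → Typeα c q b ψ w₀ → ⊥
    typeα ψ w₀ T = fan-center nearα (tree-fan (Basic.P K) keepsα hu fan t) z-b
                     (k-miss keepsα (tree-≢x t) (tree-≢y t) m)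
      where
      open Typeα T
      fan : Fan ψ z w₀ u₀
      fan with u₀ ≟ w₀
      ... | yes refl = root
      ... | no p = next root w₀-q (k-edge keepsα u₀≢y p hu)

  two-missing-y : ∀ {c} → Kite c → ∀ {r s a b u v} → Seen c r → Seen c s → Misses c y b → u ≢ v →
                  Tree c a r u → Tree c a s v → Misses c u b → Misses c v b → ⊥
  two-missing-y K (inj₂ yr) _ yb _ tu _ mu _ = y-tree K yr yb tu mu
  two-missing-y K (inj₁ _) (inj₂ ys) yb _ _ tv _ mv = y-tree K ys yb tv mv
  two-missing-y K {r} {s} {b = b} (inj₁ xr) (inj₁ xs) yb u≢v tu tv mu mv with r ≟ s
  ... | yes refl = same-tree K (inj₁ xr) yb u≢v tu tv mu mv
  -- The exchange makes y miss r while x still misses s, so the two trees are of different kinds,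
  -- and b is neither r nor s.
  ... | no r≢s = x-tree-type₀ K xr yb tu mu λ c₀ T → let open Type₀ T in
    xy-trees kite₀ (x-keep (r≢s ∘ sym) xs) y-q (colours-≢ K xs yb ∘ sym) (colours-≢ K xr yb ∘ sym) u≢v
      (tree-keep keeps₀ tu) (tree-keep keeps₀ tv)
      (k-miss keeps₀ (tree-≢x tu) (tree-≢y tu) mu) (k-miss keeps₀ (tree-≢x tv) (tree-≢y tv) mv)

  -- Shifting the v-edges frees s at z, so that by linkage w₀ and z share an (s,r)-path. As x
  -- misses s, exchanging off this path recolors xy from r to s; then yz takes s and xy takes δ.
  -- Now z misses δ, as does u in the fan at w₀.
  module Detour {c} (K : Kite c) {r s a b u v} (xr : Misses c x r) (xs : Misses c x s) (yb : Misses c y b)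
                (tu : Tree c a r u) (tv : Tree c a s v) (uδ : Misses c u δ) (vb : Misses c v b)
                {u₁} (u₁≢x : u₁ ≢ x) (u₁≢y : u₁ ≢ y) (hu : Has c z u₁ r)
                {v₁} (v₁≢y : v₁ ≢ y) (hv : Has c z v₁ s)
                {ψ w₀} (A : Typeα c r b ψ w₀) where

    open Basic K using (P; xδ; y≢z; z≢x; z≢y; x≢y; colour-≢δ; near)
    open Typeα A

    r≢b : r ≢ b
    r≢b = colours-≢ K xr yb
    s≢b : s ≢ b
    s≢b = colours-≢ K xs yb
    r≢δ : r ≢ δ
    r≢δ = colour-≢δ u₁≢y hu
    s≢δ : s ≢ δ
    s≢δ = colour-≢δ v₁≢y hv

    w₀≢z : w₀ ≢ z
    w₀≢z = root≢ nearα

    z≢v₁ : z ≢ v₁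
    z≢v₁ = Has-≢ P hv

    ≢w₀ : ∀ {t e} → e ≢ b → Has c z t e → t ≢ w₀
    ≢w₀ e≢b h refl = e≢b (Has-unique h edgeα)

    fan-u : ∀ {t} → Tree c a r t → Fan ψ z w₀ t
    fan-u = tree-fan P keepsα hu (next root w₀-q (k-edge keepsα u₁≢y (≢w₀ r≢b hu) hu))

    -- A shift confined to this set disturbs neither the fan at w₀ nor the edges xy and yz.
    S : Fin n → Set
    S t = (t ≢ x × t ≢ y) × ¬ Fan ψ z w₀ t

    hvψ : Has ψ z v₁ s
    hvψ = k-edge keepsα v₁≢y (≢w₀ s≢b hv) hv

    vbψ : Misses ψ v b
    vbψ = k-miss keepsα (tree-≢x tv) (tree-≢y tv) vb

    module EV = Erase (pr nearα) z≢v₁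

    -- The branch is read backwards from v. A vertex of it inside the fan at w₀ would draw its
    -- successor into the fan, so all of them stay outside as v does. A return to v₁ ends the
    -- search.
    path : ∀ {t} → Tree c a s t → (∃[ m ] Path EV.erase z S t v m) → ∃[ m ] Path EV.erase z S v₁ v m
    path (top _ _ h) p = subst (λ t → ∃[ m ] Path EV.erase z S t v m) (inj P h hv) p
    path {t} (ext T m _ _ t≢y h) (l , p) with t ≟ v₁
    ... | yes refl = l , p
    ... | no t≢v₁ = path T (suc l , cons ((tree-≢x T , tree-≢y T) , λ f → proj₂ (path-head p) (next f mψ hψ))
                       (EV.erase-Misses mψ) (EV.erase-Has⁻ (SE-star z≢v₁ t≢v₁) hψ) p)
      where
      mψ = k-miss keepsα (tree-≢x T) (tree-≢y T) m
      hψ = k-edge keepsα t≢y (λ { refl → proj₂ (path-head p) root }) h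

    v-path : ∃[ m ] Path EV.erase z S v₁ v m
    v-path = path tv (0 , nil ((tree-≢x tv , tree-≢y tv) , λ f → fan-center nearα f z-b vbψ))

    module Completed (¬fan-v₁ : ¬ Fan ψ z w₀ v₁) {χ : Partial n k} (near′ : Near w₀ z χ)
      (χ-δ : Misses χ z δ) (w₀r′ : Misses χ w₀ r)
      (misses′ : ∀ {t e} → t ≢ x → t ≢ y → t ≢ z → Fan ψ z w₀ t → e ≢ s → e ≢ r → Misses ψ t e →
                 Misses χ t e)
      (edge′ : ∀ {t e} → t ≢ y → Fan ψ z w₀ t → Has ψ z t e → Has χ z t e) where

      top′ : ∀ {t} → t ≢ x → t ≢ y → Has c z t r → Fan χ z w₀ t
      top′ t≢x t≢y h = next root
        w₀r′
        (edge′ t≢y (fan-u (top t≢x t≢y h)) (k-edge keepsα t≢y (≢w₀ r≢b h) h))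

      -- Only r and s may have changed as missing colors. A step by r can start at the root w₀,
      -- which misses r, and a step by s would lead to v₁, which is outside the fan.
      fan′ : ∀ {t} → Tree c a r t → Fan χ z w₀ t
      fan′ (top p q h) = top′ p q h
      fan′ {t} T@(ext {w} {e = e} T′ m _ t≢x t≢y h) with t ≟ w₀ | e ≟ r | e ≟ s
      ... | yes refl | _ | _ = root
      ... | no _ | yes refl | _ = top′ t≢x t≢y h
      ... | no _ | no _ | yes refl = ⊥-elim (¬fan-v₁ (subst (Fan ψ z w₀) (inj P h hv) (fan-u T)))
      ... | no t≢w₀ | no e≢r | no e≢s = next (fan′ T′)
        (misses′ (tree-≢x T′) (tree-≢y T′) (tree-≢z K T′) (fan-u T′) e≢s e≢r
          (k-miss keepsα (tree-≢x T′) (tree-≢y T′) m))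
        (edge′ t≢y (fan-u T) (k-edge keepsα t≢y t≢w₀ h))

      completed : ⊥
      completed = fan-center near′ (fan′ tu) χ-δ
        (misses′ (tree-≢x tu) (tree-≢y tu) (tree-≢z K tu) (fan-u tu) (s≢δ ∘ sym) (r≢δ ∘ sym)
          (k-miss keepsα (tree-≢x tu) (tree-≢y tu) uδ))

    module Moved-along {ω} (R : Shifted EV.erase z v₁ S b ω) (v₁∈S : S v₁) where

      fan-∉ : ∀ {t} → Fan ψ z w₀ t → ¬ S t
      fan-∉ f (_ , ¬f) = ¬f f

      x∉S : ¬ S x
      x∉S ((p , _) , _) = p refl

      y∉S : ¬ S y
      y∉S ((_ , p) , _) = p refl

      ω-Has : ∀ {t w e} → t ≢ z → ¬ S t → Has ω t w e → Has EV.erase t w e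
      ω-Has {t} {w} t≢z ¬s h with w ≟ z
      ... | yes refl = flip EV.erase-Proper (has (trans (sym (off R ¬s)) (color≡ (flip (proper* R) h))))
      ... | no w≢z = has (trans (sym (away R t≢z w≢z)) (color≡ h))

      ω-Misses : ∀ {t e} → t ≢ z → ¬ S t → Misses ψ t e → Misses ω t e
      ω-Misses t≢z ¬s m w h = m w (proj₁ (EV.erase-Has (ω-Has t≢z ¬s h)))

      ω-edge : ∀ {t e} → ¬ S t → Has ψ z t e → Has ω z t e
      ω-edge ¬s h = has (trans (off R ¬s) (color≡ (EV.erase-Has⁻ (SE-star z≢v₁ λ { refl → ¬s v₁∈S }) h)))

      near-ω : Near w₀ z ω
      near-ω = record { pr = proper* R ; cov = cov′ ; root≢ = w₀≢z
        ; un = trans (symm (proper* R) w₀ z) (trans (off R (fan-∉ root))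
                 (erase-keeps ψ z v₁ (trans (symm (pr nearα) z w₀) (un nearα)))) }
        where
        at-z : ∀ {t} → Adj z t → ω z t ≡ nothing → SameEdge w₀ z z t
        at-z a h with bare R h
        ... | g , t≢v₁ with EV.erase-nothing g
        ...   | inj₁ (inj₁ (_ , p)) = ⊥-elim (t≢v₁ p)
        ...   | inj₁ (inj₂ (p , _)) = ⊥-elim (z≢v₁ p)
        ...   | inj₂ g′ = cov nearα a g′
        cov′ : ∀ {s t} → Adj s t → ω s t ≡ nothing → SameEdge w₀ z s t
        cov′ {s} {t} a h with s ≟ z | t ≟ z
        ... | yes refl | _ = at-z a h
        ... | no s≢z | no t≢z with EV.erase-nothing (trans (sym (away R s≢z t≢z)) h)
        ...   | inj₁ (inj₁ (p , _)) = ⊥-elim (s≢z p)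
        ...   | inj₁ (inj₂ (_ , p)) = ⊥-elim (t≢z p)
        ...   | inj₂ g = cov nearα a g
        cov′ {s} {t} a h | no s≢z | yes refl with bare R (trans (symm (proper* R) z s) h)
        ... | g , s≢v₁ with EV.erase-nothing g
        ...   | inj₁ (inj₁ (_ , p)) = ⊥-elim (s≢v₁ p)
        ...   | inj₁ (inj₂ (p , _)) = ⊥-elim (z≢v₁ p)
        ...   | inj₂ g′ = cov nearα a (trans (symm (pr nearα) s z) g′)

      zs-ω : Misses ω z s
      zs-ω = center R (EV.erase-Misses₁ hvψ) s≢b

      w₀r-ω : Misses ω w₀ r
      w₀r-ω = ω-Misses w₀≢z (fan-∉ root) w₀-q

      Q : Fin n → Set
      Q = On ω s r w₀

      module Linked (Q? : ∀ t → Dec (Q t)) (qz : Q z) where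

        open Swap (proper* R) s r (λ t → ¬? (Q? t))
          (complement-closed (proper* R) (On-closed (proper* R) w₀r-ω))

        s≢r : s ≢ r
        s≢r refl = proj₂ v₁∈S (subst (Fan ψ z w₀) (inj P hu hv) (fan-u (top u₁≢x u₁≢y hu)))
  
        x∉ : ¬ Q x
        x∉ qx = x≢z (On-end-unique (proper* R) qx (w₀≢x ∘ sym) (inj₁ refl)
                       (ω-Misses x≢z x∉S (x-keep s≢r xs)) qz (w₀≢z ∘ sym) (inj₁ refl) zs-ω)

        xy-s : Has exchange x y s
        xy-s = ex-Has-in-b x∉ (has (trans (away R x≢z y≢z)
          (color≡ (EV.erase-Has⁻ (SE-off x≢z (v₁≢x ∘ sym)) xyα))))
          where v₁≢x = proj₁ (proj₁ v₁∈S)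

        z∈ : ¬ ¬ Q z
        z∈ ¬q = ¬q qz

        module EX = Erase ex-Proper x≢y

        yz-δ : Has EX.erase y z δ
        yz-δ = EX.erase-Has⁻ (λ { (inj₁ (p , _)) → x≢y (sym p) ; (inj₂ (_ , p)) → z≢x p })
          (ex-Has-other (s≢δ ∘ sym) (r≢δ ∘ sym) (flip (proper* R) (ω-edge y∉S (flip (pr nearα) yzα))))

        module R′ = Reroute x≢z EX.erase-Proper x≢y EX.erase-on yz-δ
          (EX.erase-Misses (ex-Misses-other (s≢δ ∘ sym) (r≢δ ∘ sym)
            (ω-Misses x≢z x∉S (x-keep (r≢δ ∘ sym) xδ))))
          s≢δ (EX.erase-Misses₂ xy-s) (EX.erase-Misses (ex-Misses-out z∈ zs-ω))

        near′ : Near w₀ z R′.reroute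
        near′ = record { pr = R′.rr-Proper ; cov = cov′ ; root≢ = w₀≢z
          ; un = R′.rr-nothing⁻ (SE-off w₀≢x w₀≢y) (SE-off w₀≢y w₀≢z)
                   (erase-keeps exchange x y (ex-nothing⁻ {w₀} {z} (un near-ω))) }
          where
          cov′ : ∀ {i j} → Adj i j → R′.reroute i j ≡ nothing → SameEdge w₀ z i j
          cov′ {i} {j} a h with R′.rr-nothing h
          ... | g , ¬p with EX.erase-nothing g
          ...   | inj₁ p = ⊥-elim (¬p p)
          ...   | inj₂ g′ = cov near-ω a (ex-nothing {i} {j} g′)

        misses′ : ∀ {t e} → t ≢ x → t ≢ y → t ≢ z → Fan ψ z w₀ t → e ≢ s → e ≢ r → Misses ψ t e →
                  Misses R′.reroute t e
        misses′ t≢x t≢y t≢z f e≢s e≢r m = R′.rr-Misses-off t≢x t≢y t≢z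
          (EX.erase-Misses (ex-Misses-other e≢s e≢r (ω-Misses t≢z (fan-∉ f) m)))

        edge′ : ∀ {t e} → t ≢ y → Fan ψ z w₀ t → Has ψ z t e → Has R′.reroute z t e
        edge′ t≢y f h = R′.rr-Has (λ { (inj₁ (p , _)) → z≢y p ; (inj₂ (_ , p)) → t≢y p })
          (EX.erase-Has⁻ (λ { (inj₁ (p , _)) → z≢x p ; (inj₂ (p , _)) → z≢y p })
            (ex-Has-out z∈ (ω-edge (fan-∉ f) h)))

        w₀r′ : Misses R′.reroute w₀ r
        w₀r′ = R′.rr-Misses-off w₀≢x w₀≢y w₀≢z (EX.erase-Misses
          (ex-Misses-out (λ ¬q → ¬q (_ , _ , _ , here)) w₀r-ω))

        absurd : ⊥
        absurd = Completed.completed (proj₂ v₁∈S) near′ R′.rr-center w₀r′ misses′ edge′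

    detour : ⊥
    detour with v-path
    ... | l , p with shift l EV.erase-Proper ≤-refl (z≢v₁ ∘ sym)
                       (trans (symm EV.erase-Proper v₁ z) EV.erase-on) p
                       (EV.erase-Misses vbψ) (EV.erase-Misses z-b)
    ...   | ω , R = link near-ω w₀r-ω zs-ω λ qz → ¬¬-decidable Q λ Q? → Linked.absurd Q? qz
      where open Moved-along R (path-head p)

  -- Wherever δ becomes free at z, the vertex u contradicts `fan-center`. With both colors missing
  -- at x, only the type that frees b instead remains, and there v supplies the end of the second
  -- shift.
  missing-δ-and-y : ∀ {c} → Kite c → ∀ {r s a b u v} → Seen c r → Seen c s → Misses c y b →
                    Tree c a r u → Tree c a s v → Misses c u δ → Misses c v b → ⊥
  missing-δ-and-y K (inj₂ yr) _ yb tu tv mu mv =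
    fan-center slid-near (slid-fan yr tu) slide-center (slide-Misses (tree-≢x tu) (tree-≢y tu) mu)
    where open Basic K
  missing-δ-and-y K (inj₁ _) (inj₂ ys) yb tu tv mu mv = y-tree K ys yb tv mv
  missing-δ-and-y {c} K {r} {s} {a} {b} {u} {v} (inj₁ xr) (inj₁ xs) yb tu tv mu mv with tree-top tu | tree-top tv
  ... | u₀ , u₀≢x , u₀≢y , hu | v₀ , _ , v₀≢y , hv = types K xr (Basic.colour-≢δ K u₀≢y hu) yb hu type₀ typeβ
      (λ ψ w₀ T → Detour.detour K xr xs yb tu tv mu mv u₀≢x u₀≢y hu v₀≢y hv T)
    where
    type₀ : ∀ c₀ → Type₀ c r b c₀ → ⊥
    type₀ c₀ T = fan-center slid-near (slid-fan y-q (tree-keep keeps₀ tu)) slide-center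
        (slide-Misses (tree-≢x tu) (tree-≢y tu) (k-miss keeps₀ (tree-≢x tu) (tree-≢y tu) mu))
      where
      open Type₀ T
      open Basic kite₀
    typeβ : ∀ ψ → Typeβ c u₀ b ψ → ⊥
    typeβ ψ T = fan-center nearβ (tree-fan (Basic.P K) keepsβ hu root tu) z-δ
                  (k-miss keepsβ (tree-≢x tu) (tree-≢y tu) mu)
      where open Typeβ T

-- Coinciding missing colors

transpose-injective : ∀ {k} (a b : Fin k) {e f} → transpose a b e ≡ transpose a b f → e ≡ f
transpose-injective a b {e} {f} p =
  trans (sym (transpose-invol a b e)) (trans (cong (transpose a b) p) (transpose-invol a b f))

module Reaching {n k : ℕ} (Adj : Fin n → Fin n → Set)
  (impossible : (c : Partial n k) → Proper c → (∀ {u v} → Adj u v → c u v ≢ nothing) → ⊥)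
  (x y z : Fin n) (δ : Fin k) (x≢z : x ≢ z) where

  open Uncolorable {n} {k} Adj impossible
  open Kites {n} {k} Adj impossible x y z δ x≢z
  open Trees {n} {k} Adj impossible x y z δ x≢z

  mutual
    data Reach (c : Partial n k) : Fin n → Set where
      reach : ∀ {v e} → v ≢ x → v ≢ y → Has c z v e → Avail c e → Reach c v

    data Avail (c : Partial n k) : Fin k → Set where
      seen : ∀ {e} → Seen c e → Avail c e
      from : ∀ {w e} → Reach c w → Misses c w e → Avail c e

  reach-≢x : ∀ {c v} → Reach c v → v ≢ x
  reach-≢x (reach p _ _ _) = p

  reach-≢y : ∀ {c v} → Reach c v → v ≢ y
  reach-≢y (reach _ p _ _) = p

  -- A step by b can be replaced by a fresh start, since b is missing at y; so steps by b can be
  -- avoided.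
  reach-tree : ∀ {c v b} → Misses c y b → Reach c v → ∃[ r ] Seen c r × Tree c b r v
  reach-tree yb (reach p q h (seen s)) = _ , s , top p q h
  reach-tree {b = b} yb (reach {e = e} p q h (from R m)) with e ≟ b | reach-tree yb R
  ... | yes refl | _ = b , inj₂ yb , top p q h
  ... | no e≢b | r , s , t = r , s , ext t m e≢b p q h

  two-reached : ∀ {c} → Kite c → ∀ {b u v} → Misses c y b → u ≢ v → Reach c u → Reach c v →
                Misses c u b → Misses c v b → ⊥
  two-reached K yb u≢v Ru Rv with reach-tree yb Ru | reach-tree yb Rv
  ... | _ , su , tu | _ , sv , tv = two-missing-y K su sv yb u≢v tu tv

  reached-δ-and-y : ∀ {c} → Kite c → ∀ {b u v} → Misses c y b → Reach c u → Reach c v →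
                    Misses c u δ → Misses c v b → ⊥
  reached-δ-and-y K yb Ru Rv with reach-tree yb Ru | reach-tree yb Rv
  ... | _ , su , tu | _ , sv , tv = missing-δ-and-y K su sv yb tu tv

  reached-center : ∀ {c} → Kite c → ∀ {b v e} → Misses c y b → Reach c v → Misses c v e → Misses c z e → ⊥
  reached-center K yb R with reach-tree yb R
  ... | _ , s , t = tree-center K s yb t

  -- Exchanging off the path from y preserves all colors missing at y. For x there are two reasons:
  -- it is on the path, or it misses neither a nor b.
  module OffPath {c} (K : Kite c) {a b} (yb : Misses c y b) (Q? : ∀ v → Dec (On c a b y v))
                 (x-ok : On c a b y x ⊎ (∀ {e} → Misses c x e → e ≢ a × e ≢ b)) where

    open Kite K
    private P = pr near

    closed : Closed c a b (λ v → ¬ On c a b y v)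
    closed = complement-closed P (On-closed P yb)

    open Swap P a b (λ v → ¬? (Q? v)) closed public

    y-in : ¬ ¬ On c a b y y
    y-in ¬q = ¬q (_ , _ , _ , here)

    x-keep : ∀ {e} → Misses c x e → Misses exchange x e
    x-keep m = case x-ok of λ where
      (inj₁ q) → ex-Misses-out (λ ¬q → ¬q q) m
      (inj₂ f) → ex-Misses-other (proj₁ (f m)) (proj₂ (f m)) m

    y-keep : ∀ {e} → Misses c y e → Misses exchange y e
    y-keep = ex-Misses-out y-in

    kite : Kite exchange
    kite = record { near = Near-swap near a b (λ v → ¬? (Q? v)) closed
                  ; yz = ex-Has-out y-in yz ; xδ = x-keep xδ }

    unseen : ∀ {e} → e ≢ a → e ≢ b → ¬ Seen c e → ¬ Seen exchange e
    unseen p q ¬s (inj₁ m) = ¬s (inj₁ λ w h → m w (ex-Has-other p q h))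
    unseen p q ¬s (inj₂ m) = ¬s (inj₂ λ w h → m w (ex-Has-other p q h))

    transposed : ∀ {v e} → (e ≡ a ⊎ e ≡ b → ¬ On c a b y v) → Misses c v e →
                 Misses exchange v (transpose a b e)
    transposed {v} {e} off-path m = case Q? v of λ where
      (no ¬q) → ex-Misses-in ¬q m
      (yes q) → let p = λ r → off-path (inj₁ r) q
                    p′ = λ r → off-path (inj₂ r) q
                in subst (Misses exchange v) (sym (transpose-other a b p p′)) (ex-Misses-other p p′ m)

    act-ab : ∀ v {e} → e ≡ a ⊎ e ≡ b → act v e ≡ a ⊎ act v e ≡ b
    act-ab v i with Q? v
    act-ab v i           | yes _ = i
    act-ab v (inj₁ refl) | no _ = inj₂ (transpose-a a b)
    act-ab v (inj₂ refl) | no _ = inj₁ (transpose-b a b)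

    module _ (av : Avail exchange a) where

      avail-ab : ∀ {e} → e ≡ a ⊎ e ≡ b → Avail exchange e
      avail-ab (inj₁ refl) = av
      avail-ab (inj₂ refl) = seen (inj₂ (y-keep yb))

      mutual
        -- If z lies off the path, its a- and b-edges trade colors; both colors are available
        -- afterwards, so these edges are reached anyway.
        reaches : ∀ {v} → Reach c v → Reach exchange v
        reaches (reach {e = e} p q h s) with e ≟ a | e ≟ b
        ... | yes r | _ = reach p q (ex-Has h) (avail-ab (act-ab z (inj₁ r)))
        ... | no _ | yes r = reach p q (ex-Has h) (avail-ab (act-ab z (inj₂ r)))
        ... | no r | no r′ = reach p q (ex-Has-other r r′ h) (avails r r′ s)

        avails : ∀ {e} → e ≢ a → e ≢ b → Avail c e → Avail exchange e
        avails _ _ (seen (inj₁ m)) = seen (inj₁ (x-keep m))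
        avails _ _ (seen (inj₂ m)) = seen (inj₂ (y-keep m))
        avails r r′ (from R m)     = from (reaches R) (ex-Misses-other r r′ m)

  record Moved (c : Partial n k) (a b : Fin k) (c′ : Partial n k) : Set where
    no-eta-equality
    field
      kite′  : Kite c′
      x-keep : ∀ {e} → Misses c x e → Misses c′ x e
      y-keep : ∀ {e} → Misses c y e → Misses c′ y e
      unseen : ∀ {e} → e ≢ a → e ≢ b → ¬ Seen c e → ¬ Seen c′ e
      reach′ : ∀ {v} → Reach c v → Reach c′ v
      moved  : ∀ {v e} → Reach c v → Misses c v e → Misses c′ v (transpose a b e)

    moved-to : ∀ {v e f} → transpose a b e ≡ f → Reach c v → Misses c v e → Misses c′ v f
    moved-to p R m = subst (Misses c′ _) p (moved R m)

  -- By linkage x is the second end of the path from y, so every reached vertex missing a or b lies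
  -- off the path and has the two colors transposed.
  move : ∀ {c} → Kite c → ∀ {a b} → Misses c x a → Misses c y b → (∀ c′ → Moved c a b c′ → ⊥) → ⊥
  move {c} K {a} {b} xa yb κ =
    link (Near-flip near) yb xa λ ox → ¬¬-decidable (On c a b y) λ Q? →
    let open OffPath K yb Q? (inj₁ ox) in
    κ exchange record
      { kite′ = kite ; x-keep = x-keep ; y-keep = y-keep ; unseen = unseen
      ; reach′ = reaches (seen (inj₁ (x-keep xa)))
      ; moved = λ R m → transposed (λ i q → reach-≢x R
          (On-end-unique (pr near) q (reach-≢y R) i m ox (root≢ near) (inj₁ refl) xa)) m }
    where open Kite K

  Seen-moved : ∀ {c a b c′} → Moved c a b c′ → Misses c x a → Misses c y b →
               ∀ {e} → Seen c e → Seen c′ (transpose a b e)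
  Seen-moved {c} {a} {b} {c′} M xa yb {e} s = go (e ≟ a) (e ≟ b)
    where
    keep : Seen c e → Seen c′ e
    keep (inj₁ m) = inj₁ (Moved.x-keep M m)
    keep (inj₂ m) = inj₂ (Moved.y-keep M m)
    go : Dec (e ≡ a) → Dec (e ≡ b) → Seen c′ (transpose a b e)
    go (yes refl) _ = subst (Seen c′) (sym (transpose-a a b)) (inj₂ (Moved.y-keep M yb))
    go (no _) (yes refl) = subst (Seen c′) (sym (transpose-b a b)) (inj₁ (Moved.x-keep M xa))
    go (no p) (no p′) = subst (Seen c′) (sym (transpose-other a b p p′)) (keep s)

  -- Treats together one color at two vertices and two colors, possibly at the same vertex.
  Apart : Fin n → Fin n → Fin k → Fin k → Set
  Apart u v e f = u ≢ v ⊎ e ≢ f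

  Apart-moved : ∀ {u v e f} a b {e′} → transpose a b e ≡ e′ → Apart u v e f → Apart u v e′ (transpose a b f)
  Apart-moved a b p (inj₁ q) = inj₁ q
  Apart-moved a b refl (inj₂ q) = inj₂ λ r → q (transpose-injective a b r)

  pair-δ : ∀ {c} → Kite c → ∀ {b u v σ} → Misses c y b → Reach c u → Misses c u δ →
           Reach c v → Misses c v σ → Seen c σ → Apart u v δ σ → ⊥
  pair-δ K yb Ru mu Rv mv (inj₂ yσ) _ = reached-δ-and-y K yσ Ru Rv mu mv
  pair-δ K {b} {σ = σ} yb Ru mu Rv mv (inj₁ xσ) d with σ ≟ δ | d
  ... | yes refl | inj₂ ¬p = ¬p refl
  -- Both vertices miss δ; the exchange turns it into b at both.
  ... | yes refl | inj₁ u≢v = move K xσ yb λ c′ M → let open Moved M in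
    two-reached kite′ (y-keep yb) u≢v (reach′ Ru) (reach′ Rv)
      (moved-to (transpose-a σ b) Ru mu) (moved-to (transpose-a σ b) Rv mv)
  ... | no σ≢δ | _ = move K xσ yb λ c′ M → let open Moved M in
    reached-δ-and-y kite′ (y-keep yb) (reach′ Ru) (reach′ Rv)
      (moved-to (transpose-other σ b (σ≢δ ∘ sym) (colours-≢ K (Kite.xδ K) yb)) Ru mu)
      (moved-to (transpose-a σ b) Rv mv)

  pair-y : ∀ {c} → Kite c → ∀ {u v τ σ} → Misses c y τ → Reach c u → Misses c u τ →
           Reach c v → Misses c v σ → Seen c σ → Apart u v τ σ → ⊥
  pair-y K {τ = τ} yτ Ru mu Rv mv s d = move K (Kite.xδ K) yτ λ c′ M → let open Moved M in
    pair-δ kite′ (y-keep yτ) (reach′ Ru) (moved-to (transpose-b δ τ) Ru mu) (reach′ Rv) (moved Rv mv)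
      (Seen-moved M (Kite.xδ K) yτ s) (Apart-moved δ τ (transpose-b δ τ) d)

  pair : ∀ {c} → Kite c → ∀ {b u v τ σ} → Misses c y b → Reach c u → Misses c u τ → Seen c τ →
         Reach c v → Misses c v σ → Seen c σ → Apart u v τ σ → ⊥
  pair K yb Ru mu (inj₂ yτ) Rv mv s d = pair-y K yτ Ru mu Rv mv s d
  pair K {b} {τ = τ} yb Ru mu (inj₁ xτ) Rv mv s d = move K xτ yb λ c′ M → let open Moved M in
    pair-y kite′ (y-keep yb) (reach′ Ru) (moved-to (transpose-a τ b) Ru mu) (reach′ Rv) (moved Rv mv)
      (Seen-moved M xτ yb s) (Apart-moved τ b (transpose-a τ b) d)

  -- Fans settle every combination except two trees that both start from colors missing at x, which
  -- is left to the continuation.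
  holders-x : ∀ {c} → Kite c → ∀ {p a r s h v} → ¬ Seen c p → h ≢ v → Misses c h p → Misses c v p →
              Seen c r → Tree c a r h → Seen c s → Tree c a s v →
              (Misses c x r → Misses c x s → ⊥) → ⊥
  holders-x K ¬p h≢v mh mv (inj₁ xr) th (inj₁ xs) tv κ = κ xr xs
  holders-x K ¬p h≢v mh mv (inj₂ yr) th (inj₂ ys) tv κ = y-trees K yr ys h≢v th tv mh mv
  holders-x K ¬p h≢v mh mv (inj₂ yr) th (inj₁ xs) tv κ =
    xy-trees K xs yr (λ { refl → ¬p (inj₁ xs) }) (λ { refl → ¬p (inj₂ yr) }) h≢v th tv mh mv
  holders-x K ¬p h≢v mh mv (inj₁ xr) th (inj₂ ys) tv κ =
    xy-trees K xr ys (λ { refl → ¬p (inj₁ xr) }) (λ { refl → ¬p (inj₂ ys) }) (h≢v ∘ sym) tv th mv mh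

  record Converted (c : Partial n k) (p b : Fin k) (c′ : Partial n k) : Set where
    no-eta-equality
    field
      kite′  : Kite c′
      y-keep : ∀ {e} → Misses c y e → Misses c′ y e
      unseen : ∀ {e} → e ≢ p → e ≢ b → ¬ Seen c e → ¬ Seen c′ e
      reach′ : ∀ {v} → Reach c v → Reach c′ v
      other  : ∀ {v e} → e ≢ p → e ≢ b → Misses c v e → Misses c′ v e
      t      : Fin n
      t-in   : Reach c′ t
      t-b    : Misses c′ t b

  module Convert {c} (K : Kite c) {p b} (yb : Misses c y b) (¬p : ¬ Seen c p)
                 (Q? : ∀ v → Dec (On c p b y v)) where

    p≢ : ∀ {e} → Seen c e → e ≢ p
    p≢ s refl = ¬p s

    open OffPath K {p} {b} yb Q? (inj₂ λ m → p≢ (inj₁ m) , colours-≢ K m yb)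

    -- Before the exchange p is not known to stay available, so a branch is followed only until it
    -- would use p; the vertex w that offers p is itself still reached.
    conv : ∀ {r v} → Misses c x r → Tree c b r v →
           Reach exchange v ⊎ (∃[ w ] Tree c b r w × Misses c w p × Reach exchange w)
    conv xr (top q q′ h) = inj₁ (reach q q′ (ex-Has-other (p≢ (inj₁ xr)) (colours-≢ K xr yb) h)
                                  (seen (inj₁ (x-keep xr))))
    conv xr (ext {w} {e = e} t m e≢b q q′ h) with conv xr t | e ≟ p
    ... | inj₂ i | _ = inj₂ i
    ... | inj₁ R | yes refl = inj₂ (w , t , m , R)
    ... | inj₁ R | no e≢p = inj₁ (reach q q′ (ex-Has-other e≢p e≢b h) (from R (ex-Misses-other e≢p e≢b m)))

    -- A branch cut short at w has w and v in one tree, both missing p, so they coincide.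
    conv-holder : ∀ {r v} → Misses c x r → Tree c b r v → Misses c v p → (Reach exchange v → ⊥) → ⊥
    conv-holder {v = v} xr t m κ with conv xr t
    ... | inj₁ R = κ R
    ... | inj₂ (w , t′ , m′ , R) with w ≟ v
    ...   | yes refl = κ R
    ...   | no w≢v = same-tree K (inj₁ xr) yb w≢v t′ t m′ m

    both : ∀ {h v} → h ≢ v → Reach c h → Reach c v → Misses c h p → Misses c v p →
           (Reach exchange h → Reach exchange v → ⊥) → ⊥
    both h≢v Rh Rv mh mv κ with reach-tree yb Rh | reach-tree yb Rv
    ... | _ , sh , th | _ , sv , tv = holders-x K ¬p h≢v mh mv sh th sv tv λ xr xs →
      conv-holder xr th mh λ Rh′ → conv-holder xs tv mv λ Rv′ → κ Rh′ Rv′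

    two-off : ∀ {h v} → h ≢ v → Reach c h → Reach c v → Misses c h p → Misses c v p →
              ¬ On c p b y h → ¬ On c p b y v → ⊥
    two-off h≢v Rh Rv mh mv ¬h ¬v = both h≢v Rh Rv mh mv λ Rh′ Rv′ →
      two-reached kite (y-keep yb) h≢v Rh′ Rv′ (ex-Misses-in-a ¬h mh) (ex-Misses-in-a ¬v mv)

    two-on : ∀ {h v} → h ≢ v → Reach c h → Reach c v → Misses c h p → Misses c v p →
             On c p b y h → On c p b y v → ⊥
    two-on h≢v Rh Rv mh mv oh ov = h≢v (On-end-unique (pr (Kite.near K))
      oh (reach-≢y Rh) (inj₁ refl) mh ov (reach-≢y Rv) (inj₁ refl) mv)

    convert : ∀ {h v} → h ≢ v → Reach c h → Reach c v → Misses c h p → Misses c v p →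
              (∀ c′ → Converted c p b c′ → ⊥) → ⊥
    convert {h} {v} h≢v Rh Rv mh mv κ = go (Q? h) (Q? v)
      where
      -- The holder on the path keeps p available, so everything stays reached, and the one off the
      -- path turns p into b.
      one-on : ∀ {h v} → h ≢ v → Reach c h → Reach c v → Misses c h p → Misses c v p →
               On c p b y h → ¬ On c p b y v → ⊥
      one-on {h} {v} h≢v Rh Rv mh mv oh ¬v = both h≢v Rh Rv mh mv λ Rh′ Rv′ → κ exchange record
        { kite′ = kite ; y-keep = y-keep ; unseen = unseen
        ; reach′ = reaches (from Rh′ (ex-Misses-out (λ ¬q → ¬q oh) mh))
        ; other = ex-Misses-other ; t = v ; t-in = Rv′ ; t-b = ex-Misses-in-a ¬v mv }
      go : Dec (On c p b y h) → Dec (On c p b y v) → ⊥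
      go (yes oh) (yes ov) = two-on h≢v Rh Rv mh mv oh ov
      go (yes oh) (no ¬v)  = one-on h≢v Rh Rv mh mv oh ¬v
      go (no ¬h) (yes ov)  = one-on (h≢v ∘ sym) Rv Rh mv mh ov ¬h
      go (no ¬h) (no ¬v)   = two-off h≢v Rh Rv mh mv ¬h ¬v

    -- Two of three holders are on the same side of the path from y.
    three : ∀ {u v w} → u ≢ v → u ≢ w → v ≢ w → Reach c u → Reach c v → Reach c w →
            Misses c u p → Misses c v p → Misses c w p → ⊥
    three {u} {v} {w} u≢v u≢w v≢w Ru Rv Rw mu mv mw = go (Q? u) (Q? v) (Q? w)
      where
      go : Dec (On c p b y u) → Dec (On c p b y v) → Dec (On c p b y w) → ⊥
      go (yes a) (yes d) _       = two-on u≢v Ru Rv mu mv a d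
      go (no a)  (no d)  _       = two-off u≢v Ru Rv mu mv a d
      go (yes a) (no d)  (yes e) = two-on u≢w Ru Rw mu mw a e
      go (yes a) (no d)  (no e)  = two-off v≢w Rv Rw mv mw d e
      go (no a)  (yes d) (yes e) = two-on v≢w Rv Rw mv mw d e
      go (no a)  (yes d) (no e)  = two-off u≢w Ru Rw mu mw a e

  record Holders (c : Partial n k) (p : Fin k) : Set where
    no-eta-equality
    field
      unseen-p : ¬ Seen c p
      h v      : Fin n
      h≢v      : h ≢ v
      h-in     : Reach c h
      v-in     : Reach c v
      h-p      : Misses c h p
      v-p      : Misses c v p

  converting : ∀ {c} → Kite c → ∀ {p b} → Misses c y b → Holders c p → (∀ c′ → Converted c p b c′ → ⊥) → ⊥
  converting {c} K {p} {b} yb H κ = ¬¬-decidable (On c p b y) λ Q? →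
    Convert.convert K yb unseen-p Q? h≢v h-in v-in h-p v-p κ
    where open Holders H

  three-holders : ∀ {c} → Kite c → ∀ {p b} → Misses c y b → ¬ Seen c p → ∀ {u v w} → u ≢ v → u ≢ w → v ≢ w →
                  Reach c u → Reach c v → Reach c w → Misses c u p → Misses c v p → Misses c w p → ⊥
  three-holders {c} K {p} {b} yb ¬p u≢v u≢w v≢w Ru Rv Rw mu mv mw = ¬¬-decidable (On c p b y) λ Q? →
    Convert.three K yb ¬p Q? u≢v u≢w v≢w Ru Rv Rw mu mv mw

  Holders-moved : ∀ {c a b c′ p} → Moved c a b c′ → Misses c x a → Misses c y b → Holders c p → Holders c′ p
  Holders-moved {a = a} {b} M xa yb H = record
    { unseen-p = unseen p≢a p≢b unseen-p ; h≢v = h≢v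
    ; h-in = reach′ h-in ; v-in = reach′ v-in
    ; h-p = moved-to same h-in h-p ; v-p = moved-to same v-in v-p }
    where
    open Holders H
    open Moved M
    p≢a = λ p≡a → unseen-p (inj₁ (subst (Misses _ x) (sym p≡a) xa))
    p≢b = λ p≡b → unseen-p (inj₂ (subst (Misses _ y) (sym p≡b) yb))
    same = transpose-other a b p≢a p≢b

  holders-δ : ∀ {c} → Kite c → ∀ {p b g} → Misses c y b → Holders c p → Reach c g → Misses c g δ → ⊥
  holders-δ K yb H Rg mg = converting K yb H λ c′ V → let open Converted V in
    reached-δ-and-y kite′ (y-keep yb) (reach′ Rg) t-in
      (other (λ { refl → Holders.unseen-p H (inj₁ (Kite.xδ K)) }) (colours-≢ K (Kite.xδ K) yb) mg) t-b

  holders-y : ∀ {c} → Kite c → ∀ {p τ g} → Misses c y τ → Holders c p → Reach c g → Misses c g τ → ⊥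
  holders-y K {τ = τ} yτ H Rg mg = move K (Kite.xδ K) yτ λ c′ M → let open Moved M in
    holders-δ kite′ (y-keep yτ) (Holders-moved M (Kite.xδ K) yτ H) (reach′ Rg) (moved-to (transpose-b δ τ) Rg mg)

  holders-seen : ∀ {c} → Kite c → ∀ {p τ b g} → Misses c y b → Holders c p → Reach c g → Seen c τ → Misses c g τ → ⊥
  holders-seen K yb H Rg (inj₂ yτ) mg = holders-y K yτ H Rg mg
  holders-seen K {τ = τ} {b} yb H Rg (inj₁ xτ) mg = move K xτ yb λ c′ M → let open Moved M in
    holders-y kite′ (y-keep yb) (Holders-moved M xτ yb H) (reach′ Rg) (moved-to (transpose-a τ b) Rg mg)

  -- Converting p makes a reached vertex miss b and leaves the holders of p′ as they were.
  two-holders : ∀ {c} → Kite c → ∀ {p p′ b} → Misses c y b → p′ ≢ p → Holders c p → Holders c p′ → ⊥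
  two-holders K {b = b} yb p′≢p H H′ = converting K yb H λ c′ V →
    let open Converted V
        open Holders H′
        p′≢b = λ p′≡b → unseen-p (inj₂ (subst (Misses _ y) (sym p′≡b) yb))
    in holders-y kite′ (y-keep yb)
      (record { unseen-p = unseen p′≢p p′≢b unseen-p ; h≢v = h≢v ; h-in = reach′ h-in ; v-in = reach′ v-in
              ; h-p = other p′≢p p′≢b h-p ; v-p = other p′≢p p′≢b v-p }) t-in t-b

-- Edge-colorings of graphs

has? : ∀ {n k} (c : Partial n k) u v e → Dec (Has c u v e)
has? c u v e = map′ has color≡ (≡-dec _≟_ (c u v) (just e))

misses? : ∀ {n k} (c : Partial n k) v e → Dec (Misses c v e)
misses? c v e with any? (λ w → has? c v w e)
... | yes (w , h) = no λ m → m w h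
... | no ¬h = yes λ w h → ¬h (w , h)

≤-max : ∀ {A : Set} (f : A → ℕ) {v xs} → v ∈ xs → f v ≤ foldr _⊔_ 0 (map f xs)
≤-max f {v} {w ∷ ws} (here refl) = m≤m⊔n (f v) _
≤-max f {v} {w ∷ ws} (there i)   = ≤-trans (≤-max f i) (m≤n⊔m (f w) _)

degree≤Δ : ∀ {n} (G : Graph n) v → degree G v ≤ Δ G
degree≤Δ G v = ≤-max (degree G) (∈-allFin v)

neighbours-≤-degree : ∀ {n} (G : Graph n) v {l} (g : Fin l → Fin n) → (∀ i → Adj G v (g i)) →
                      (∀ {i j} → g i ≡ g j → i ≡ j) → l ≤ degree G v
neighbours-≤-degree G v {l} g a g-inj = go (l ≤? degree G v)
  where
  ns = filter (adj? G v) (allFin _)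
  mem : ∀ i → g i ∈ ns
  mem i = ∈-filter⁺ (adj? G v) (∈-allFin (g i)) (a i)
  go : Dec (l ≤ degree G v) → l ≤ degree G v
  go (yes p) = p
  go (no ¬p) with pigeonhole (≰⇒> ¬p) (λ i → index (mem i))
  ... | i , j , i<j , eq = ⊥-elim (Fin.<⇒≢ i<j (g-inj
        (trans (lookup-index (mem i)) (trans (cong (lookup ns) eq) (sym (lookup-index (mem j)))))))

get : ∀ {A : Set} (o : Maybe A) → o ≢ nothing → A
get (just a) _ = a
get nothing p  = ⊥-elim (p refl)

get-just : ∀ {A : Set} (o : Maybe A) (p : o ≢ nothing) → o ≡ just (get o p)
get-just (just a) _ = refl
get-just nothing p  = ⊥-elim (p refl)

total-coloring : ∀ {n k} (G : Graph n) (c : Partial n k) → Proper c →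
                 (∀ {u v} → Adj G u v → c u v ≢ nothing) → EdgeColoring G k
total-coloring G c P cov = record
  { color = λ {u} {v} e → get (c u v) (cov e)
  ; color-sym = λ {u} {v} e f → just-injective
      (trans (sym (get-just (c u v) (cov e))) (trans (symm P u v) (get-just (c v u) (cov f))))
  ; proper = λ {u} {v} {w} v≢w e f eq → v≢w (inj P (has (get-just (c u v) (cov e)))
      (has (trans (get-just (c u w) (cov f)) (cong just (sym eq))))) }

module FromColoring {n k} (H : Graph n) (φ : EdgeColoring H k) where

  color-irr : ∀ {u v} (e f : Adj H u v) → color φ e ≡ color φ f
  color-irr e f = trans (color-sym φ e (adj-sym H f)) (sym (color-sym φ f (adj-sym H f)))

  opaque
    c : Partial n k
    c u v with adj? H u v
    ... | yes e = just (color φ e)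
    ... | no _  = nothing

    c-color : ∀ {u v} (e : Adj H u v) → Has c u v (color φ e)
    c-color {u} {v} e = has go
      where
      go : c u v ≡ just (color φ e)
      go with adj? H u v
      ... | yes f = cong just (color-irr f e)
      ... | no ¬e = ⊥-elim (¬e e)

    c-edge : ∀ {u v α} → Has c u v α → Σ[ e ∈ Adj H u v ] color φ e ≡ α
    c-edge {u} {v} (has h) with adj? H u v
    ... | yes e = e , just-injective h
    c-edge (has ()) | no _

    c-none : ∀ {u v} → ¬ Adj H u v → c u v ≡ nothing
    c-none {u} {v} ¬e with adj? H u v
    ... | yes e = ⊥-elim (¬e e)
    ... | no _  = refl

  c-Proper : Proper c
  c-Proper = record { symm = sy ; inj = in′ ; irref = λ u → c-none (adj-irrefl H refl) }
    where
    sy : ∀ u v → c u v ≡ c v u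
    sy u v with adj? H u v
    ... | yes e = trans (color≡ (c-color e))
        (trans (cong just (color-sym φ e (adj-sym H e))) (sym (color≡ (c-color (adj-sym H e)))))
    ... | no ¬e = trans (c-none ¬e) (sym (c-none (¬e ∘ adj-sym H)))
    in′ : ∀ {u v w e} → Has c u v e → Has c u w e → v ≡ w
    in′ {v = v} {w} h h′ with v ≟ w | c-edge h | c-edge h′
    ... | yes p | _ | _ = p
    ... | no v≢w | e , p | f , q = ⊥-elim (proper φ v≢w e f (trans p (sym q)))

  to-Misses : ∀ {v α} → Missing φ v α → Misses c v α
  to-Misses m w h = m (w , c-edge h)

-- Extracting coincidences from the sum

sum≥1 : ∀ {A : Set} (f : A → ℕ) xs → 1 ≤ sum (map f xs) → ∃[ β ] β ∈ xs × 1 ≤ f β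
sum≥1 f (w ∷ ws) p with f w in eq
... | zero with sum≥1 f ws p
...   | β , i , q = β , there i , q
sum≥1 f (w ∷ ws) p | suc _ = w , here refl , subst (1 ≤_) (sym eq) (s≤s z≤n)

-- The two alternatives are one color missing at three broom vertices and two colors each missing at
-- two of them.
sum≥2 : ∀ {A : Set} (f : A → ℕ) {xs} → Unique xs → 2 ≤ sum (map f xs) →
        (∃[ α ] 2 ≤ f α) ⊎ (∃[ α ] ∃[ β ] α ≢ β × 1 ≤ f α × 1 ≤ f β)
sum≥2 f {w ∷ ws} (d ∷ ds) p with f w in eq
... | zero = sum≥2 f ds p
... | suc (suc _) = inj₁ (w , subst (2 ≤_) (sym eq) (s≤s (s≤s z≤n)))
... | suc zero with p
...   | s≤s p′ with sum≥1 f ws p′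
...     | β , i , q = inj₂ (w , β , All.lookup d i , subst (1 ≤_) (sym eq) (s≤s z≤n) , q)

two-elements : ∀ {A : Set} {xs : List A} → Unique xs → 1 ≤ length xs ∸ 1 →
               ∃[ u ] ∃[ v ] u ≢ v × u ∈ xs × v ∈ xs
two-elements {xs = u ∷ v ∷ _} ((p ∷ _) ∷ _) _ = u , v , p , here refl , there (here refl)

three-elements : ∀ {A : Set} {xs : List A} → Unique xs → 2 ≤ length xs ∸ 1 →
                 ∃[ u ] ∃[ v ] ∃[ w ] (u ≢ v × u ≢ w × v ≢ w) × u ∈ xs × v ∈ xs × w ∈ xs
three-elements {xs = u ∷ v ∷ []} _ (s≤s ())
three-elements {xs = u ∷ v ∷ w ∷ _} ((p ∷ q ∷ _) ∷ (r ∷ _) ∷ _) _ =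
  u , v , w , (p , q , r) , here refl , there (here refl) , there (there (here refl))

Any-take : ∀ {A : Set} {P : A → Set} xs (i : Fin (length xs)) → Any P (take (toℕ i) xs) →
           ∃[ j ] toℕ j < toℕ i × P (lookup xs j)
Any-take (w ∷ ws) (suc i) (here p) = zero , s≤s z≤n , p
Any-take (w ∷ ws) (suc i) (there a) with Any-take ws i a
... | j , lt , p = suc j , s≤s lt , p

-- Application to the broom

module Broom {n : ℕ} (G : Graph n) (crit : Critical G) {x y : Fin n} (xy : Adj G x y)
             (φ : EdgeColoring (deleteEdge G x y) (Δ G)) (B : ShortBroom G xy φ) where

  open ShortBroom B hiding (broomVertices)
  open FromColoring (deleteEdge G x y) φ

  impossible : (c : Partial n (Δ G)) → Proper c → (∀ {u v} → Adj G u v → c u v ≢ nothing) → ⊥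
  impossible c P cov = n≮n _ (proj₂ (Critical.class2 crit) (Δ G) (total-coloring G c P cov))

  δ : Fin (Δ G)
  δ = color φ yz

  x≢z : x ≢ z
  x≢z with distinct
  ... | (_ ∷ p ∷ _) ∷ _ = p

  open Uncolorable (Adj G) impossible using (Near; common; pr)
  open Kites (Adj G) impossible x y z δ x≢z using (Kite; module Basic)
  open Trees (Adj G) impossible x y z δ x≢z using (Seen)
  open Reaching (Adj G) impossible x y z δ x≢z

  near-xy : Near x y c
  near-xy = record
    { pr = c-Proper ; cov = cov′ ; un = c-none λ (_ , ¬p) → ¬p (inj₁ (refl , refl))
    ; root≢ = λ p → adj-irrefl G p xy }
    where
    cov′ : ∀ {u v} → Adj G u v → c u v ≡ nothing → SameEdge x y u v
    cov′ {u} {v} a h with sameEdge? x y u v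
    ... | yes p = p
    ... | no ¬p = ⊥-elim (nothing-≢ h (c-color (a , ¬p)))

  K : Kite c
  K = record { near = near-xy ; yz = c-color yz ; xδ = to-Misses yz-missing }

  -- If all Δ colors appeared at y, their edges together with xy would give y Δ + 1 neighbors.
  y-missing : ∃[ b ] Misses c y b
  y-missing with any? (misses? c y)
  ... | yes p = p
  ... | no ¬p = ⊥-elim (n≮n _ (≤-trans (neighbours-≤-degree G y g g-adj (g-inj _ _)) (degree≤Δ G y)))
    where
    at : ∀ b → ∃[ w ] Has c y w b
    at b with any? (λ w → has? c y w b)
    ... | yes p = p
    ... | no ¬h = ⊥-elim (¬p (b , λ w h → ¬h (w , h)))
    g : Fin (suc (Δ G)) → Fin n
    g zero    = x
    g (suc b) = proj₁ (at b)
    g-adj : ∀ i → Adj G y (g i)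
    g-adj zero    = adj-sym G xy
    g-adj (suc b) = proj₁ (proj₁ (c-edge (proj₂ (at b))))
    x≢at : ∀ b → x ≢ proj₁ (at b)
    x≢at b p = proj₂ (proj₁ (c-edge (proj₂ (at b)))) (inj₂ (refl , sym p))
    g-inj : ∀ i j → g i ≡ g j → i ≡ j
    g-inj zero zero _       = refl
    g-inj zero (suc b) p    = ⊥-elim (x≢at b p)
    g-inj (suc b) zero p    = ⊥-elim (x≢at b (sym p))
    g-inj (suc b) (suc b′) p =
      cong suc (Has-unique (proj₂ (at b)) (Has-cong (sym p) (proj₂ (at b′))))

  b = proj₁ y-missing
  yb = proj₂ y-missing

  vs-≢ : ∀ {v} → v ∈ vs → v ≢ x × v ≢ y
  vs-≢ i with distinct
  ... | (_ ∷ _ ∷ px) ∷ (_ ∷ py) ∷ _ = (λ p → All.lookup px i (sym p)) , (λ p → All.lookup py i (sym p))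

  -- The recursion jumps to an arbitrary earlier index, so it descends on the bound `N`.
  reached : ∀ N i → toℕ i < N → Reach c (lookup vs i)
  reached (suc N) i (s≤s lt) = reach (proj₁ (vs-≢ (∈-lookup i))) (proj₂ (vs-≢ (∈-lookup i)))
    (c-color (zv i)) (available (zv-missing i))
    where
    available : Any (λ v → Missing φ v (color φ (zv i))) (x ∷ y ∷ z ∷ take (toℕ i) vs) →
                Avail c (color φ (zv i))
    available (here m) = seen (inj₁ (to-Misses m))
    available (there (here m)) = seen (inj₂ (to-Misses m))
    -- The color of an edge at z is present at z.
    available (there (there (here m))) = ⊥-elim (m (_ , zv i , refl))
    available (there (there (there a))) with Any-take vs i a
    ... | j , j<i , m = from (reached N j (≤-trans j<i lt)) (to-Misses m)

  Low : Fin n → Set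
  Low v = v ≡ x ⊎ v ≡ y

  place : ∀ {v} → v ∈ broomVertices B → v ≡ z ⊎ Low v ⊎ Reach c v
  place (here p) = inj₂ (inj₁ (inj₁ p))
  place (there (here p)) = inj₂ (inj₁ (inj₂ p))
  place (there (there (here p))) = inj₁ p
  place (there (there (there i))) =
    inj₂ (inj₂ (subst (Reach c) (sym (lookup-index i)) (reached _ (index i) ≤-refl)))

  low-seen : ∀ {v α} → Low v → Misses c v α → Seen c α
  low-seen (inj₁ refl) m = inj₁ m
  low-seen (inj₂ refl) m = inj₂ m

  two-low : ∀ {u v α} → u ≢ v → Low u → Low v → Misses c u α → Misses c v α → ⊥
  two-low u≢v (inj₁ refl) (inj₁ refl) _ _  = u≢v refl
  two-low u≢v (inj₁ refl) (inj₂ refl) m m′ = common near-xy m m′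
  two-low u≢v (inj₂ refl) (inj₁ refl) m m′ = common near-xy m′ m
  two-low u≢v (inj₂ refl) (inj₂ refl) _ _  = u≢v refl

  -- No missing color of z is missing at another broom vertex, so z never takes part in a
  -- coincidence.
  off-z : ∀ {u v α} → u ≢ v → u ∈ broomVertices B → v ∈ broomVertices B →
          Misses c u α → Misses c v α → Low u ⊎ Reach c u
  off-z u≢v i j mu mv with place i | place j
  ... | inj₂ p | _ = p
  ... | inj₁ refl | inj₁ refl = ⊥-elim (u≢v refl)
  ... | inj₁ refl | inj₂ (inj₁ (inj₁ refl)) = ⊥-elim (Basic.xz-disjoint K yb mv mu)
  ... | inj₁ refl | inj₂ (inj₁ (inj₂ refl)) = ⊥-elim (Basic.yz-disjoint K mv mu)
  ... | inj₁ refl | inj₂ (inj₂ R) = ⊥-elim (reached-center K yb R mv mu)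

  seen? : ∀ α → Dec (Seen c α)
  seen? α = misses? c x α ⊎-dec misses? c y α

  Twin : Fin (Δ G) → Set
  Twin α = (Seen c α × ∃[ v ] Reach c v × Misses c v α) ⊎ Holders c α

  missing : Fin (Δ G) → List (Fin n)
  missing α = filter (λ v → missing? φ v α) (broomVertices B)

  missing⁻ : ∀ {v} α → v ∈ missing α → v ∈ broomVertices B × Misses c v α
  missing⁻ α i with ∈-filter⁻ (λ v → missing? φ v α) i
  ... | j , m = j , to-Misses m

  unique-missing : ∀ α → Unique (missing α)
  unique-missing α = filter⁺ (λ v → missing? φ v α) distinct

  twin : ∀ α → 1 ≤ m φ B α → Twin α
  twin α le with two-elements (unique-missing α) le
  ... | u , v , u≢v , iu , iv with missing⁻ α iu | missing⁻ α iv
  ...   | ju , mu | jv , mv with off-z u≢v ju jv mu mv | off-z (u≢v ∘ sym) jv ju mv mu | seen? α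
  ...     | inj₁ lu | inj₁ lv | _ = ⊥-elim (two-low u≢v lu lv mu mv)
  ...     | inj₁ lu | inj₂ Rv | _ = inj₁ (low-seen lu mu , v , Rv , mv)
  ...     | inj₂ Ru | inj₁ lv | _ = inj₁ (low-seen lv mv , u , Ru , mu)
  ...     | inj₂ Ru | inj₂ Rv | yes s = inj₁ (s , u , Ru , mu)
  ...     | inj₂ Ru | inj₂ Rv | no ¬s = inj₂ record
            { unseen-p = ¬s ; h≢v = u≢v ; h-in = Ru ; v-in = Rv ; h-p = mu ; v-p = mv }

  no-triple : ∀ α → 2 ≤ m φ B α → ⊥
  no-triple α le with three-elements (unique-missing α) le
  ... | u , v , w , (u≢v , u≢w , v≢w) , iu , iv , iw
    with missing⁻ α iu | missing⁻ α iv | missing⁻ α iw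
  ...   | ju , mu | jv , mv | jw , mw
    with off-z u≢v ju jv mu mv | off-z (u≢v ∘ sym) jv ju mv mu | off-z (u≢w ∘ sym) jw ju mw mu | seen? α
  ...     | inj₁ lu | inj₁ lv | _ | _ = two-low u≢v lu lv mu mv
  ...     | inj₁ lu | inj₂ _ | inj₁ lw | _ = two-low u≢w lu lw mu mw
  ...     | inj₂ _ | inj₁ lv | inj₁ lw | _ = two-low v≢w lv lw mv mw
  ...     | inj₁ lu | inj₂ Rv | inj₂ Rw | _ =
            pair K yb Rv mv (low-seen lu mu) Rw mw (low-seen lu mu) (inj₁ v≢w)
  ...     | inj₂ Ru | inj₁ lv | inj₂ Rw | _ =
            pair K yb Ru mu (low-seen lv mv) Rw mw (low-seen lv mv) (inj₁ u≢w)
  ...     | inj₂ Ru | inj₂ Rv | _ | yes s = pair K yb Ru mu s Rv mv s (inj₁ u≢v)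
  ...     | inj₂ Ru | inj₂ Rv | inj₁ lw | no ¬s = ¬s (low-seen lw mw)
  ...     | inj₂ Ru | inj₂ Rv | inj₂ Rw | no ¬s =
            three-holders K yb ¬s u≢v u≢w v≢w Ru Rv Rw mu mv mw

  no-two-twins : ∀ {α β} → α ≢ β → Twin α → Twin β → ⊥
  no-two-twins α≢β (inj₁ (s , _ , R , m)) (inj₁ (s′ , _ , R′ , m′)) = pair K yb R m s R′ m′ s′ (inj₂ α≢β)
  no-two-twins α≢β (inj₁ (s , _ , R , m)) (inj₂ H) = holders-seen K yb H R s m
  no-two-twins α≢β (inj₂ H) (inj₁ (s , _ , R , m)) = holders-seen K yb H R s m
  no-two-twins α≢β (inj₂ H) (inj₂ H′) = two-holders K yb (α≢β ∘ sym) H H′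

theorem1p1 :
    ∀ {n : ℕ} (G : Graph n) → Critical G →
    ∀ {x y : Fin n} (xy : Adj G x y)
      (φ : EdgeColoring (deleteEdge G x y) (Δ G))
      (B : ShortBroom G xy φ) →
    ∑-colors (m φ B) ≤ 1
theorem1p1 G crit xy φ B with ∑-colors (m φ B) ≤? 1
... | yes p = p
... | no ¬p with sum≥2 (m φ B) (allFin⁺ (Δ G)) (≰⇒> ¬p)
...   | inj₁ (α , le) = ⊥-elim (Broom.no-triple G crit xy φ B α le)
...   | inj₂ (α , β , α≢β , le , le′) =
        ⊥-elim (no-two-twins α≢β (twin α le) (twin β le′))
  where open Broom G crit xy φ B
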